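{- Let $\tau$ be an arithmetic signature and let $k$ be a number. For each first-order $\tau_{k\text{ -colors}}$-sentence $\phi$ in negation normal form in which no $C_i$ occurs inside the scope of a universal quantifier, there is a $\tau$-sentence $\phi'$ such that: (1) for all $\mathcal A \in \mathrm{STRUC}[\tau]$ we have $\mathcal A \models \phi'$ if and only if there is a $k$-coloring $\mathcal B$ of $\mathcal A$ with $\mathcal B \models \phi$; (2) $\mathrm{qr}(\phi') = \mathrm{qr}(\phi) + O(1)$; (3) $|\mathrm{bound}(\phi')| = |\mathrm{bound}(\phi)| + O(1)$, where $O(1)$ denotes a global constant independent of $\tau$ and $k$.
   Context: A signature $\tau$ is arithmetic if it contains $<$, ternary $\mathrm{add}$, ternary $\mathrm{mult}$, the unary function symbol $\mathrm{succ}$ and the constant $0$; $\mathrm{STRUC}[\tau]$ then contains only finite $\tau$-structures where $<$ is a linear order and $\mathrm{add},\mathrm{mult},\mathrm{succ},0$ have their natural meaning relative to this order (successor of the maximum is itself, $0$ is the minimum). For a number $k$, $\tau_{k\text{ -colors}} = \tau \cup \{C_1,\dots,C_k\}$ with fresh unary relation symbols $C_i$. A $k$-coloring of a $\tau$-structure $\mathcal A$ is a $\tau_{k\text{ -colors}}$-structure $\mathcal B$ whose $\tau$-restriction is $\mathcal A$ and in which $C_1^{\mathcal B},\dots,C_k^{\mathcal B}$ form a partition of the universe of $\mathcal A$ (color classes may be empty). A formula is in negation normal form if negations are applied only to atomic formulas. $\mathrm{qr}(\phi)$ is the quantifier rank and $\mathrm{bound}(\phi)$ the set of bound variables of $\phi$.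 -}

module Defs where

open import Data.Bool using (Bool; T; if_then_else_)
open import Data.Empty using (⊥)
open import Data.Fin using (Fin)
open import Data.List using (List; []; _∷_; _++_; deduplicate)
open import Data.Nat using (ℕ; suc; _+_; _*_; _⊔_; _≟_)
open import Data.Product using (∃; ∃!; _×_; proj₁; proj₂)
open import Data.Sum using (_⊎_)
open import Data.Unit using (⊤)
open import Data.Vec using (Vec; []; _∷_; countᵇ; tabulate)
open import Function.Bundles using (_↔_; _⇔_; module Inverse)
open import Relation.Binary.PropositionalEquality using (_≡_; _≢_)
open import Relation.Binary.Structures using (IsStrictTotalOrder)
open import Relation.Nullary using (¬_; does)

-- Symbols are indexed by their arity; constants are nullary function symbols.
record Signature : Set₁ where
  field
    Rel : ℕ → Set
    Fun : ℕ → Set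

open Signature public

record Arithmetic (τ : Signature) : Set where
  field
    lt       : Rel τ 2
    add mult : Rel τ 3
    succ     : Fun τ 1
    zero     : Fun τ 0
    add≢mult : add ≢ mult

data ColorRel (τ : Signature) (k : ℕ) : ℕ → Set where
  base  : ∀ {n} → Rel τ n → ColorRel τ k n
  color : Fin k → ColorRel τ k 1

_colors_ : Signature → ℕ → Signature
τ colors k = record { Rel = ColorRel τ k ; Fun = Fun τ }

data Term (τ : Signature) : Set where
  var : ℕ → Term τ
  fun : ∀ {n} → Fun τ n → Vec (Term τ) n → Term τ

infix  8 _≐_
infix  7 ¬′_
infixr 6 _∧′_
infixr 5 _∨′_

data Formula (τ : Signature) : Set where
  _≐_       : Term τ → Term τ → Formula τ
  rel       : ∀ {n} → Rel τ n → Vec (Term τ) n → Formula τ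
  ¬′_       : Formula τ → Formula τ
  _∧′_ _∨′_ : Formula τ → Formula τ → Formula τ
  ∃′ ∀′     : ℕ → Formula τ → Formula τ

module _ {τ : Signature} where

  mutual
    OccursInTerm : ℕ → Term τ → Set
    OccursInTerm x (var y)    = x ≡ y
    OccursInTerm x (fun f ts) = OccursInTerms x ts

    OccursInTerms : ∀ {n} → ℕ → Vec (Term τ) n → Set
    OccursInTerms x []       = ⊥
    OccursInTerms x (t ∷ ts) = OccursInTerm x t ⊎ OccursInTerms x ts

  FreeIn : ℕ → Formula τ → Set
  FreeIn x (s ≐ t)    = OccursInTerm x s ⊎ OccursInTerm x t
  FreeIn x (rel R ts) = OccursInTerms x ts
  FreeIn x (¬′ φ)     = FreeIn x φ
  FreeIn x (φ ∧′ ψ)   = FreeIn x φ ⊎ FreeIn x ψ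
  FreeIn x (φ ∨′ ψ)   = FreeIn x φ ⊎ FreeIn x ψ
  FreeIn x (∃′ y φ)   = x ≢ y × FreeIn x φ
  FreeIn x (∀′ y φ)   = x ≢ y × FreeIn x φ

  IsSentence : Formula τ → Set
  IsSentence φ = ∀ x → ¬ FreeIn x φ

  data Atomic : Formula τ → Set where
    _≐_ : ∀ s t → Atomic (s ≐ t)
    rel : ∀ {n} (R : Rel τ n) ts → Atomic (rel R ts)

  NNF : Formula τ → Set
  NNF (s ≐ t)    = ⊤
  NNF (rel R ts) = ⊤
  NNF (¬′ φ)     = Atomic φ
  NNF (φ ∧′ ψ)   = NNF φ × NNF ψ
  NNF (φ ∨′ ψ)   = NNF φ × NNF ψ
  NNF (∃′ x φ)   = NNF φ
  NNF (∀′ x φ)   = NNF φ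

  qr : Formula τ → ℕ
  qr (s ≐ t)    = 0
  qr (rel R ts) = 0
  qr (¬′ φ)     = qr φ
  qr (φ ∧′ ψ)   = qr φ ⊔ qr ψ
  qr (φ ∨′ ψ)   = qr φ ⊔ qr ψ
  qr (∃′ x φ)   = suc (qr φ)
  qr (∀′ x φ)   = suc (qr φ)

  quantifiedVars : Formula τ → List ℕ
  quantifiedVars (s ≐ t)    = []
  quantifiedVars (rel R ts) = []
  quantifiedVars (¬′ φ)     = quantifiedVars φ
  quantifiedVars (φ ∧′ ψ)   = quantifiedVars φ ++ quantifiedVars ψ
  quantifiedVars (φ ∨′ ψ)   = quantifiedVars φ ++ quantifiedVars ψ
  quantifiedVars (∃′ x φ)   = x ∷ quantifiedVars φ
  quantifiedVars (∀′ x φ)   = x ∷ quantifiedVars φ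

  -- The duplicate-free list of bound variables, so its length is |bound(φ)|:
  -- a variable quantified several times counts once.
  bound : Formula τ → List ℕ
  bound φ = deduplicate _≟_ (quantifiedVars φ)

module _ {τ : Signature} {k : ℕ} where

  OccursColor : Fin k → Formula (τ colors k) → Set
  OccursColor i (s ≐ t)             = ⊥
  OccursColor i (rel (base R) ts)   = ⊥
  OccursColor i (rel (color j) ts)  = i ≡ j
  OccursColor i (¬′ φ)              = OccursColor i φ
  OccursColor i (φ ∧′ ψ)            = OccursColor i φ ⊎ OccursColor i ψ
  OccursColor i (φ ∨′ ψ)            = OccursColor i φ ⊎ OccursColor i ψ
  OccursColor i (∃′ x φ)            = OccursColor i φ
  OccursColor i (∀′ x φ)            = OccursColor i φ

  NoColorUnder∀ : Formula (τ colors k) → Set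
  NoColorUnder∀ (s ≐ t)    = ⊤
  NoColorUnder∀ (rel R ts) = ⊤
  NoColorUnder∀ (¬′ φ)     = NoColorUnder∀ φ
  NoColorUnder∀ (φ ∧′ ψ)   = NoColorUnder∀ φ × NoColorUnder∀ ψ
  NoColorUnder∀ (φ ∨′ ψ)   = NoColorUnder∀ φ × NoColorUnder∀ ψ
  NoColorUnder∀ (∃′ x φ)   = NoColorUnder∀ φ
  NoColorUnder∀ (∀′ x φ)   = ∀ i → ¬ OccursColor i φ

-- Finite structures. Relations are Bool-valued, i.e. two-valued as in classical
-- model theory; over a finite universe satisfaction is then decidable.
record Structure (τ : Signature) : Set₁ where
  field
    Carrier : Set
    finite  : ∃ λ n → Carrier ↔ Fin n
    ⟦rel⟧   : ∀ {n} → Rel τ n → Vec Carrier n → Bool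
    ⟦fun⟧   : ∀ {n} → Fun τ n → Vec Carrier n → Carrier

  elements : Vec Carrier (proj₁ finite)
  elements = tabulate (Inverse.from (proj₂ finite))

module _ {τ : Signature} (A : Structure τ) where
  open Structure A

  mutual
    eval : (ℕ → Carrier) → Term τ → Carrier
    eval ρ (var x)    = ρ x
    eval ρ (fun f ts) = ⟦fun⟧ f (evals ρ ts)

    evals : ∀ {n} → (ℕ → Carrier) → Vec (Term τ) n → Vec Carrier n
    evals ρ []       = []
    evals ρ (t ∷ ts) = eval ρ t ∷ evals ρ ts

  _[_↦_] : (ℕ → Carrier) → ℕ → Carrier → ℕ → Carrier
  (ρ [ x ↦ a ]) y = if does (x ≟ y) then a else ρ y

  Sat : (ℕ → Carrier) → Formula τ → Set
  Sat ρ (s ≐ t)    = eval ρ s ≡ eval ρ t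
  Sat ρ (rel R ts) = T (⟦rel⟧ R (evals ρ ts))
  Sat ρ (¬′ φ)     = ¬ Sat ρ φ
  Sat ρ (φ ∧′ ψ)   = Sat ρ φ × Sat ρ ψ
  Sat ρ (φ ∨′ ψ)   = Sat ρ φ ⊎ Sat ρ ψ
  Sat ρ (∃′ x φ)   = ∃ λ a → Sat (ρ [ x ↦ a ]) φ
  Sat ρ (∀′ x φ)   = ∀ a → Sat (ρ [ x ↦ a ]) φ

infix 4 _⊨_

-- Used for sentences only, where the assignment is irrelevant.
_⊨_ : ∀ {τ} → Structure τ → Formula τ → Set
A ⊨ φ = ∀ ρ → Sat A ρ φ

module ArithmeticSymbols {τ : Signature} (ar : Arithmetic τ) (A : Structure τ) where
  open Structure A
  open Arithmetic ar

  _<ᵇ_ : Carrier → Carrier → Bool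
  x <ᵇ y = ⟦rel⟧ lt (x ∷ y ∷ [])

  _<_ : Carrier → Carrier → Set
  x < y = T (x <ᵇ y)

  Add Mult : Carrier → Carrier → Carrier → Set
  Add  x y z = T (⟦rel⟧ add  (x ∷ y ∷ z ∷ []))
  Mult x y z = T (⟦rel⟧ mult (x ∷ y ∷ z ∷ []))

  Succ : Carrier → Carrier
  Succ x = ⟦fun⟧ succ (x ∷ [])

  Zero : Carrier
  Zero = ⟦fun⟧ zero []

  -- The number of elements below x, i.e. the natural number that x stands for
  -- in the given order.
  rank : Carrier → ℕ
  rank x = countᵇ (_<ᵇ x) elements

-- Membership of A in STRUC[τ] for arithmetic τ.
record STRUC {τ : Signature} (ar : Arithmetic τ) (A : Structure τ) : Set where
  open ArithmeticSymbols ar A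
  field
    <-linear  : IsStrictTotalOrder _≡_ _<_
    add-rank  : ∀ x y z → Add x y z ⇔ rank x + rank y ≡ rank z
    mult-rank : ∀ x y z → Mult x y z ⇔ rank x * rank y ≡ rank z
    succ-next : ∀ x y → x < y → rank (Succ x) ≡ suc (rank x)
    succ-max  : ∀ x → (∀ y → ¬ x < y) → Succ x ≡ x
    zero-min  : ∀ x → ¬ x < Zero

reduct : ∀ {τ k} → Structure (τ colors k) → Structure τ
reduct B = record
  { Carrier = Carrier
  ; finite  = finite
  ; ⟦rel⟧   = λ R → ⟦rel⟧ (base R)
  ; ⟦fun⟧   = ⟦fun⟧
  }
  where open Structure B

record IsColoring {τ : Signature} (k : ℕ) (A : Structure τ)
                  (B : Structure (τ colors k)) : Set₁ where
  open Structure B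
  field
    restricts : reduct B ≡ A
    partition : ∀ x → ∃! _≡_ λ (i : Fin k) → T (⟦rel⟧ (color i) (x ∷ []))

{-# OPTIONS --safe #-}

-- A witness of φ inspects the colours of at most ℓ elements, ℓ being the number of
-- colour atoms.  So φ′ need only quantify over a definable family of colourings
-- that realises every prescription of colours on ℓ elements.  In a large structure
-- three elements m, b, a describe such a colouring: x has colour i when
-- 1 + ((x mod m) k + i + 1) b divides a.  Here m does not divide any difference of
-- the ℓ elements, b makes the relevant moduli pairwise coprime, and a is the product
-- of the wanted ones.  An m of size n ^ ε exists, because the numbers 1 + j Q, for
-- j ≤ r and r ! dividing Q, are pairwise coprime; hence b and a stay below n.  In the
-- finitely many small structures all elements are values of numerals, and φ′ tries
-- every list of colours.
module Submission where

open import Defs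
open import Data.Bool using (Bool; true; false; T)
open import Data.Empty using (⊥-elim)
open import Data.Fin as Fin using (Fin; zero; suc; toℕ)
import Data.Fin.Properties as Fin
open import Data.List
  using (List; []; _∷_; [_]; _++_; length; map; upTo; downFrom; allFin; cartesianProductWith)
open import Data.List.Extrema.Nat using (argmax; f[xs]≤f[argmax])
open import Data.List.Membership.Propositional using (_∈_)
open import Data.List.Membership.Propositional.Properties hiding (finite)
open import Data.List.Properties using (length-map; length-++; length-downFrom)
open import Data.List.Relation.Unary.All as All using (All; []; _∷_)
open import Data.List.Relation.Unary.All.Properties using (++⁺)
open import Data.List.Relation.Unary.AllPairs using ([]; _∷_)
open import Data.List.Relation.Unary.Any using (here; there)
open import Data.List.Relation.Unary.Unique.DecPropositional.Properties using (deduplicate-!)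
open import Data.List.Relation.Unary.Unique.Propositional using (Unique)
open import Data.List.Relation.Unary.Unique.Propositional.Properties
  using () renaming (map⁺ to unique-map⁺)
open import Data.Nat hiding (compare)
open import Data.Nat.Coprimality as Coprime using (Coprime; coprime-divisor)
open import Data.Nat.DivMod
open import Data.Nat.Divisibility
open import Data.Nat.ListAction using (product)
open import Data.Nat.ListAction.Properties using (∈⇒∣product; product≢0)
open import Data.Nat.Properties
open import Data.Nat.Tactic.RingSolver using (solve-∀)
open import Data.Product using (∃; _×_; _,_; proj₁; proj₂; map₂)
open import Data.Product.Function.NonDependent.Propositional using (_×-⇔_)
open import Data.Sum using (_⊎_; inj₁; inj₂; [_,_]′) renaming (map₂ to map-⊎₂)
open import Data.Sum.Function.Propositional using (_⊎-⇔_)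
open import Data.Unit using (tt)
open import Data.Vec as Vec using (Vec; []; _∷_; countᵇ)
import Data.Vec.Membership.Propositional as Vec
import Data.Vec.Membership.Propositional.Properties as Vec
open import Data.Vec.Relation.Unary.Any using (here; there)
open import Function using (_∘_; case_of_)
open import Function.Bundles using (_⇔_; mk⇔; module Equivalence; module Inverse)
open import Function.Properties.Equivalence using () renaming (trans to ⇔-trans)
open import Function.Properties.Inverse using (↔⇒↣)
open import Relation.Binary.Definitions using (tri<; tri≈; tri>)
open import Relation.Binary.PropositionalEquality hiding ([_])
open import Relation.Binary.Structures using (IsStrictTotalOrder)
open import Relation.Nullary using (¬_; Dec; yes; no; contradiction)
open import Relation.Nullary.Decidable
  using (⌊_⌋; T?; ¬?; _×-dec_; _⊎-dec_; map′; toWitness; fromWitness; via-injection; decidable-stable)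

open Equivalence

-- Pairwise coprime moduli and perfect hashing

-- The obstacle is the budget. The numbers k and ℓ are unbounded, yet only constantly many
-- quantifiers and variables may be added, and arithmetic stops at the largest rank t, so each
-- intermediate number of the colour formula must be at most t. Gödel's β function applied to x
-- itself has indices of size t k already; this is why x is first replaced by a residue. Two demands
-- on m then compete: it must not divide a product of differences that is bounded only by t ^ (ℓ *
-- ℓ), while a fixed power of m k must be at most t. There is no circularity in the exponents: `E`
-- depends on k and ℓ alone, and `r` is chosen afterwards, beyond 2 E ℓ². Pairwise coprime
-- candidates for m do the work of primes, so no estimate on primes enters. φ′ never verifies that
-- its parameters encode anything: any parameters define some colouring, which gives the converse
-- direction. The constant 12 is 3 parameters, plus 1 quantifier naming the argument of a colour
-- atom, plus the 8 quantifiers of `hashed`; it is also the number of reserved variables.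

coprime-* : ∀ {a b c} → Coprime a b → Coprime a c → Coprime a (b * c)
coprime-* a⊥b a⊥c (d∣a , d∣bc) =
  a⊥c (d∣a , coprime-divisor (λ (e∣d , e∣b) → a⊥b (∣-trans e∣d d∣a , e∣b)) d∣bc)

coprime-product : ∀ {a} bs → (∀ {b} → b ∈ bs → Coprime a b) → Coprime a (product bs)
coprime-product []       a⊥bs (_ , d∣1) = ∣1⇒≡1 d∣1
coprime-product (b ∷ bs) a⊥bs =
  coprime-* (a⊥bs (here refl)) (coprime-product bs (a⊥bs ∘ there))

coprime-*-∣ : ∀ {a b n} → Coprime a b → a ∣ n → b ∣ n → a * b ∣ n
coprime-*-∣ {a} {b} a⊥b (divides-refl q) b∣qa =
  subst (_∣ q * a) (*-comm b a)
    (*-monoˡ-∣ a (coprime-divisor (Coprime.sym a⊥b) (subst (b ∣_) (*-comm q a) b∣qa)))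

∣m∣n⇒∣n∸m : ∀ {d m n} → m ≤ n → d ∣ m → d ∣ n → d ∣ n ∸ m
∣m∣n⇒∣n∸m {d} m≤n d∣m d∣n = ∣m+n∣m⇒∣n (subst (d ∣_) (sym (m+[n∸m]≡n m≤n)) d∣n) d∣m

∣-∣-divisible : ∀ {d m n} → d ∣ m → d ∣ n → d ∣ ∣ m - n ∣
∣-∣-divisible {d} {m} {n} d∣m d∣n with ≤-total m n
... | inj₁ m≤n = subst (d ∣_) (sym (m≤n⇒∣m-n∣≡n∸m m≤n)) (∣m∣n⇒∣n∸m m≤n d∣m d∣n)
... | inj₂ n≤m = subst (d ∣_) (sym (m≤n⇒∣n-m∣≡n∸m n≤m)) (∣m∣n⇒∣n∸m n≤m d∣n d∣m)

-- The moduli of Gödel's β function.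
modulus : ℕ → ℕ → ℕ
modulus b u = suc (u * b)

-- A common divisor divides v (1 + u b) - u (1 + v b) = v - u, hence b, hence u b, hence 1.
modulus-coprime : ∀ {b u v} → ∣ u - v ∣ ∣ b → Coprime (modulus b u) (modulus b v)
modulus-coprime {b} {u} {v} u-v∣b {d} (d∣u , d∣v) =
  ∣1⇒≡1 (∣m+n∣m⇒∣n (subst (d ∣_) (+-comm 1 (u * b)) d∣u) (∣n⇒∣m*n u (∣-trans d∣diff u-v∣b)))
  where
  cross : ∣ v * modulus b u - u * modulus b v ∣ ≡ ∣ u - v ∣
  cross = begin
    ∣ v * modulus b u - u * modulus b v ∣
      ≡⟨ cong₂ ∣_-_∣ (expand v u b) (trans (expand u v b) (cong (_+ u) (cong (_* b) (*-comm u v)))) ⟩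
    ∣ v * u * b + v - v * u * b + u ∣       ≡⟨ ∣m+n-m+o∣≡∣n-o∣ (v * u * b) v u ⟩
    ∣ v - u ∣                               ≡⟨ ∣-∣-comm v u ⟩
    ∣ u - v ∣                               ∎
    where
    open ≡-Reasoning
    expand : ∀ v u b → v * suc (u * b) ≡ v * u * b + v
    expand = solve-∀
  d∣diff : d ∣ ∣ u - v ∣
  d∣diff = subst (d ∣_) cross (∣-∣-divisible (∣n⇒∣m*n v d∣u) (∣n⇒∣m*n u d∣v))

-- The value 1 on the diagonal keeps the product over all ordered pairs nonzero.
distance : ℕ → ℕ → ℕ
distance u v with u ≟ v
... | yes _ = 1
... | no  _ = ∣ u - v ∣

distance-≢ : ∀ {u v} → u ≢ v → distance u v ≡ ∣ u - v ∣
distance-≢ {u} {v} u≢v with u ≟ v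
... | yes u≡v = contradiction u≡v u≢v
... | no  _   = refl

distance-nonZero : ∀ u v → NonZero (distance u v)
distance-nonZero u v with u ≟ v
... | yes _   = _
... | no  u≢v = ≢-nonZero (u≢v ∘ ∣m-n∣≡0⇒m≡n)

distance-≤ : ∀ {u v B} → 1 ≤ B → u ≤ B → v ≤ B → distance u v ≤ B
distance-≤ {u} {v} 1≤B u≤B v≤B with u ≟ v
... | yes _ = 1≤B
... | no  _ = ≤-trans (∣m-n∣≤m⊔n u v) (⊔-lub u≤B v≤B)

-- It serves twice. Taken of the ranks, each non-divisor of it is an injective hash modulus; taken
-- of the colour indices, it is the `b` that makes the moduli coprime.
discriminant : List ℕ → ℕ
discriminant us = product (cartesianProductWith distance us us)

product-≤ : ∀ {B} ns → (∀ {n} → n ∈ ns → n ≤ B) → product ns ≤ B ^ length ns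
product-≤ []       _    = ≤-refl
product-≤ (n ∷ ns) ns≤B = *-mono-≤ (ns≤B (here refl)) (product-≤ ns (ns≤B ∘ there))

length-cartesianProductWith : ∀ {A B C : Set} (f : A → B → C) xs ys →
  length (cartesianProductWith f xs ys) ≡ length xs * length ys
length-cartesianProductWith f []       ys = refl
length-cartesianProductWith f (x ∷ xs) ys =
  trans (length-++ (map (f x) ys))
        (cong₂ _+_ (length-map (f x) ys) (length-cartesianProductWith f xs ys))

module _ (us : List ℕ) where

  discriminant-nonZero : NonZero (discriminant us)
  discriminant-nonZero = product≢0 (All.tabulate λ d∈ →
    case ∈-cartesianProductWith⁻ distance us us d∈ of λ where
      (u , v , _ , _ , refl) → distance-nonZero u v)

  ∣discriminant : ∀ {u v} → u ∈ us → v ∈ us → u ≢ v → ∣ u - v ∣ ∣ discriminant us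
  ∣discriminant u∈ v∈ u≢v =
    subst (_∣ _) (distance-≢ u≢v) (∈⇒∣product (∈-cartesianProductWith⁺ distance u∈ v∈))

  discriminant-≤ : ∀ {B e} → 1 ≤ B → (∀ {u} → u ∈ us → u ≤ B) → length us ≤ e →
    discriminant us ≤ B ^ (e * e)
  discriminant-≤ {B@(suc _)} {e} 1≤B us≤B len = begin
    discriminant us                                   ≤⟨ product-≤ _ all≤ ⟩
    B ^ length (cartesianProductWith distance us us)
      ≡⟨ cong (B ^_) (length-cartesianProductWith distance us us) ⟩
    B ^ (length us * length us)                       ≤⟨ ^-monoʳ-≤ B (*-mono-≤ len len) ⟩
    B ^ (e * e)                                       ∎
    where
    open ≤-Reasoning
    all≤ : ∀ {d} → d ∈ cartesianProductWith distance us us → d ≤ B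
    all≤ d∈ with ∈-cartesianProductWith⁻ distance us us d∈
    ... | u , v , u∈ , v∈ , refl = distance-≤ 1≤B (us≤B u∈) (us≤B v∈)

-- Hash moduli of moderate size

%≡⇒∣ : ∀ m .{{_ : NonZero m}} x y → x % m ≡ y % m → m ∣ ∣ x - y ∣
%≡⇒∣ m x y eq = divides ∣ x / m - y / m ∣ (begin
  ∣ x - y ∣
    ≡⟨ cong₂ ∣_-_∣ (m≡m%n+[m/n]*n x m) (m≡m%n+[m/n]*n y m) ⟩
  ∣ x % m + x / m * m - y % m + y / m * m ∣
    ≡⟨ cong (λ r → ∣ x % m + x / m * m - r + y / m * m ∣) (sym eq) ⟩
  ∣ x % m + x / m * m - x % m + y / m * m ∣
    ≡⟨ ∣m+n-m+o∣≡∣n-o∣ (x % m) _ _ ⟩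
  ∣ x / m * m - y / m * m ∣
    ≡⟨ *-distribʳ-∣-∣ m (x / m) (y / m) ⟨
  ∣ x / m - y / m ∣ * m ∎)
  where open ≡-Reasoning

∣! : ∀ {d r} → 1 ≤ d → d ≤ r → d ∣ r !
∣! {suc d} _ d≤r = ∣-trans (m∣m*n (d !)) (m≤n⇒m!∣n! d≤r)

module _ (r Q : ℕ) (r!∣Q : r ! ∣ Q) where

  moduliProduct : ℕ → ℕ
  moduliProduct zero    = 1
  moduliProduct (suc j) = modulus Q (suc j) * moduliProduct j

  moduliProduct-≥ : ∀ j → suc Q ^ j ≤ moduliProduct j
  moduliProduct-≥ zero    = ≤-refl
  moduliProduct-≥ (suc j) = *-mono-≤ (s≤s (m≤m+n Q (j * Q))) (moduliProduct-≥ j)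

  -- Two different indices up to r differ by a number between 1 and r, which divides r ! and
  -- therefore Q.
  modulus-coprime-moduliProduct : ∀ i j → j < i → i ≤ r → Coprime (modulus Q i) (moduliProduct j)
  modulus-coprime-moduliProduct i zero    _   _   (_ , d∣1) = ∣1⇒≡1 d∣1
  modulus-coprime-moduliProduct i (suc j) j<i i≤r = coprime-*
    (modulus-coprime {Q} {i} {suc j} (∣-trans
      (subst (_∣ r !) (sym (m≤n⇒∣n-m∣≡n∸m (<⇒≤ j<i)))
        (∣! (m<n⇒0<n∸m j<i) (≤-trans (m∸n≤m i (suc j)) i≤r)))
      r!∣Q))
    (modulus-coprime-moduliProduct i j (<⇒≤ j<i) i≤r)

  moduliProduct-∣ : ∀ {D} → (∀ {i} → i < r → modulus Q (suc i) ∣ D) → ∀ j → j ≤ r → moduliProduct j ∣ D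
  moduliProduct-∣ all∣D zero    _   = 1∣ _
  moduliProduct-∣ all∣D (suc j) j<r = coprime-*-∣
    (modulus-coprime-moduliProduct (suc j) j ≤-refl j<r)
    (all∣D j<r) (moduliProduct-∣ all∣D j (<⇒≤ j<r))

  -- If all moduli divided D, so would their product, which is at least (1 + Q) ^ r.
  nondivisor : ∀ D .{{_ : NonZero D}} → D < suc Q ^ r → ∃ λ j → j < r × ¬ modulus Q (suc j) ∣ D
  nondivisor D D<Q^r with anyUpTo? (λ j → ¬? (modulus Q (suc j) ∣? D)) r
  ... | yes found = found
  ... | no  none  = contradiction
    (≤-trans (moduliProduct-≥ r) (∣⇒≤ (moduliProduct-∣ all∣D r ≤-refl))) (<⇒≱ D<Q^r)
    where
    all∣D : ∀ {i} → i < r → modulus Q (suc i) ∣ D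
    all∣D {i} i<r = decidable-stable (modulus Q (suc i) ∣? D) (λ ∤D → none (i , i<r , ∤D))

-- Encoding the colours of few elements by three small numbers

crossing : ∀ (f : ℕ → ℕ) {t} s d → f s ≤ t → t < f (d + s) →
  ∃ λ T → s ≤ T × f T ≤ t × t < f (suc T)
crossing f s zero    f≤t t<f = contradiction t<f (≤⇒≯ f≤t)
crossing f {t} s (suc d) f≤t t<f with f (suc s) ≤? t
... | no  f≰t = s , ≤-refl , f≤t , ≰⇒> f≰t
... | yes f≤t′ with crossing f (suc s) d f≤t′ (subst (λ n → t < f n) (sym (+-suc d s)) t<f)
...   | T , s<T , rest = T , <⇒≤ s<T , rest

-- Mixed radix with the colour as digit below k. The additional 1 excludes index 0, whose modulus 1
-- would divide every `a`.
colorIndex : ℕ → ℕ → ℕ → ℕ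
colorIndex k y i = y * k + suc i

colorIndex-injective : ∀ {k y y′ i i′} → i < k → i′ < k →
  colorIndex k y i ≡ colorIndex k y′ i′ → y ≡ y′ × i ≡ i′
colorIndex-injective {k@(suc _)} {y} {y′} {i} {i′} i<k i′<k eq =
    *-cancelʳ-≡ y y′ k (+-cancelˡ-≡ i _ _ (trans eq″ (cong (_+ y′ * k) (sym i≡i′))))
  , i≡i′
  where
  eq″ : i + y * k ≡ i′ + y′ * k
  eq″ = suc-injective (trans (+-comm (suc i) (y * k)) (trans eq (+-comm (y′ * k) (suc i′))))
  i≡i′ : i ≡ i′
  i≡i′ = begin
    i                  ≡⟨ m<n⇒m%n≡m i<k ⟨
    i % k              ≡⟨ [m+kn]%n≡m%n i y k ⟨
    (i + y * k) % k    ≡⟨ cong (_% k) eq″ ⟩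
    (i′ + y′ * k) % k  ≡⟨ [m+kn]%n≡m%n i′ y′ k ⟩
    i′ % k             ≡⟨ m<n⇒m%n≡m i′<k ⟩
    i′                 ∎
    where open ≡-Reasoning

colorIndex-≤ : ∀ {k y i M} → i < k → y < M → colorIndex k y i ≤ M * k
colorIndex-≤ {k} {y} {i} i<k y<M = ≤-trans
  (+-monoʳ-≤ (y * k) i<k) (≤-trans (≤-reflexive (+-comm (y * k) k)) (*-monoˡ-≤ k y<M))

-- (m , b , a) encodes the colouring of xs by c: i is the colour of x when
-- the modulus with index (x mod m) k + i + 1 divides a.
record Encodes (k t : ℕ) (xs : List ℕ) (c : ℕ → ℕ) (m b a : ℕ) : Set where
  field
    {{m-nonZero}} : NonZero m
    m≤t : m ≤ t
    b≤t : b ≤ t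
    a≤t : a ≤ t

  code : ℕ → ℕ → ℕ
  code x i = modulus b (colorIndex k (x % m) i)

  field
    code≤t      : ∀ {x i} → x ∈ xs → i < k → code x i ≤ t
    index≤t     : ∀ {x i} → x ∈ xs → i < k → colorIndex k (x % m) i ≤ t
    code-color  : ∀ {x} → x ∈ xs → code x (c x) ∣ a
    code-sound  : ∀ {x i} → x ∈ xs → i < k → code x i ∣ a → i ≡ c x

module Scale (k r E : ℕ) {{_ : NonZero k}} {{_ : NonZero r}} {{_ : NonZero E}} where

  -- With Q = r ! T this is the base G = 1 + (1 + r Q) k, where 1 + r Q bounds all candidates for
  -- the hash modulus.
  limit : ℕ → ℕ
  limit T = suc (suc (r * (r ! * T)) * k)

  -- From here on the linear function `limit (suc T)` is at most T * T, because it is at most 2 c₀ T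
  -- with c₀ = 1 + k + r (r !) k.
  T₀ : ℕ
  T₀ = 2 * suc (k + r * r ! * k)

  limit-≥ : ∀ T → suc T ≤ limit T
  limit-≥ T = s≤s (begin
    T                          ≤⟨ m≤n*m T (r !) {{r !≢0}} ⟩
    r ! * T                    ≤⟨ m≤n*m (r ! * T) r ⟩
    r * (r ! * T)              ≤⟨ n≤1+n _ ⟩
    suc (r * (r ! * T))        ≤⟨ m≤m*n _ k ⟩
    suc (r * (r ! * T)) * k    ∎)
    where open ≤-Reasoning

  -- Maximality of T bounds t by a power of `limit (suc T)`; this turns it into a power of Q whose
  -- exponent does not depend on T.
  limit-suc-≤ : ∀ T → T₀ ≤ T → limit (suc T) ≤ (r ! * T) * (r ! * T)
  limit-suc-≤ T T₀≤T = begin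
    limit (suc T)              ≡⟨ expand r (r !) T k ⟩
    c₀ + p * T                 ≤⟨ +-monoʳ-≤ c₀ (*-monoˡ-≤ T (m≤n+m p (suc k))) ⟩
    c₀ + c₀ * T                ≤⟨ +-monoˡ-≤ (c₀ * T) (m≤m*n c₀ T {{>-nonZero 1≤T}}) ⟩
    c₀ * T + c₀ * T            ≡⟨ double c₀ T ⟩
    2 * c₀ * T                 ≤⟨ *-monoˡ-≤ T T₀≤T ⟩
    T * T                      ≤⟨ *-mono-≤ T≤Q T≤Q ⟩
    (r ! * T) * (r ! * T)      ∎
    where
    open ≤-Reasoning
    p = r * r ! * k
    c₀ = suc (k + p)
    1≤T : 1 ≤ T
    1≤T = ≤-trans (s≤s z≤n) T₀≤T
    T≤Q : T ≤ r ! * T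
    T≤Q = m≤n*m T (r !) {{r !≢0}}
    expand : ∀ r f T k → suc (suc (r * (f * suc T)) * k) ≡ suc (k + r * f * k) + r * f * k * T
    expand = solve-∀
    double : ∀ c T → c * T + c * T ≡ 2 * c * T
    double = solve-∀

  scale : ∀ {t} → limit T₀ ^ E ≤ t → ∃ λ T → T₀ ≤ T × limit T ^ E ≤ t × t < limit (suc T) ^ E
  scale {t} thr≤t = crossing (λ T → limit T ^ E) T₀ t thr≤t (begin-strict
    t                      ≤⟨ m≤m+n t T₀ ⟩
    t + T₀                 <⟨ limit-≥ (t + T₀) ⟩
    limit (t + T₀)         ≡⟨ ^-identityʳ _ ⟨
    limit (t + T₀) ^ 1     ≤⟨ ^-monoʳ-≤ (limit (t + T₀)) (>-nonZero⁻¹ E) ⟩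
    limit (t + T₀) ^ E     ∎)
    where open ≤-Reasoning

InjectiveMod : List ℕ → (m : ℕ) {{_ : NonZero m}} → Set
InjectiveMod xs m = ∀ {x x′} → x ∈ xs → x′ ∈ xs → x % m ≡ x′ % m → x ≡ x′

injectiveMod : ∀ xs m {{_ : NonZero m}} → ¬ m ∣ discriminant xs → InjectiveMod xs m
injectiveMod xs m m∤D {x} {x′} x∈ x′∈ eq with x ≟ x′
... | yes x≡x′ = x≡x′
... | no  x≢x′ = contradiction (∣-trans (%≡⇒∣ m x x′ eq) (∣discriminant xs x∈ x′∈ x≢x′)) m∤D

module Codes (k ℓ m M : ℕ) {{_ : NonZero k}} {{_ : NonZero m}} (m≤M : m ≤ M)
  (xs : List ℕ) (len : length xs ≤ ℓ) (inj : InjectiveMod xs m)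
  (c : ℕ → ℕ) (c<k : ∀ x → c x < k) where

  -- `B` bounds the colour indices. At most ℓ k of them occur, so their discriminant has at most `e`
  -- factors.
  B G e : ℕ
  B = M * k
  G = suc B
  e = ℓ * k * (ℓ * k)

  index : ℕ → ℕ → ℕ
  index x i = colorIndex k (x % m) i

  us : List ℕ
  us = cartesianProductWith index xs (downFrom k)

  b : ℕ
  b = discriminant us

  code : ℕ → ℕ → ℕ
  code x i = modulus b (index x i)

  codes : List ℕ
  codes = map (λ x → code x (c x)) xs

  a : ℕ
  a = product codes

  1≤B : 1 ≤ B
  1≤B = *-mono-≤ (≤-trans (>-nonZero⁻¹ m) m≤M) (>-nonZero⁻¹ k)

  index≤B : ∀ x {i} → i < k → index x i ≤ B
  index≤B x i<k = colorIndex-≤ i<k (<-≤-trans (m%n<n x m) m≤M)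

  us≤B : ∀ {u} → u ∈ us → u ≤ B
  us≤B u∈ with ∈-cartesianProductWith⁻ index xs (downFrom k) u∈
  ... | x , i , _ , i∈ , refl = index≤B x (∈-downFrom⁻ i∈)

  b≤ : b ≤ G ^ e
  b≤ = ≤-trans
    (discriminant-≤ us 1≤B us≤B (begin
      length us                        ≡⟨ length-cartesianProductWith index xs (downFrom k) ⟩
      length xs * length (downFrom k)  ≤⟨ *-mono-≤ len (≤-reflexive (length-downFrom k)) ⟩
      ℓ * k                            ∎))
    (^-monoˡ-≤ e (n≤1+n B))
    where open ≤-Reasoning

  code≤ : ∀ x {i} → i < k → code x i ≤ G ^ suc e
  -- 1 + index b ≤ G ^ e + B G ^ e = G ^ (1 + e).
  code≤ x i<k = +-mono-≤ (m^n>0 G e) (*-mono-≤ (index≤B x i<k) b≤)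

  a≤ : a ≤ G ^ (suc e * ℓ)
  a≤ = begin
    a                           ≤⟨ product-≤ codes codes≤ ⟩
    (G ^ suc e) ^ length codes  ≡⟨ cong ((G ^ suc e) ^_) (length-map _ xs) ⟩
    (G ^ suc e) ^ length xs     ≡⟨ ^-*-assoc G (suc e) (length xs) ⟩
    G ^ (suc e * length xs)     ≤⟨ ^-monoʳ-≤ G (*-monoʳ-≤ (suc e) len) ⟩
    G ^ (suc e * ℓ)             ∎
    where
    open ≤-Reasoning
    codes≤ : ∀ {n} → n ∈ codes → n ≤ G ^ suc e
    codes≤ n∈ with ∈-map⁻ _ n∈
    ... | x , x∈ , refl = code≤ x (c<k x)

  code-color : ∀ {x} → x ∈ xs → code x (c x) ∣ a
  code-color x∈ = ∈⇒∣product (∈-map⁺ _ x∈)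

  index-injective : ∀ {x x′ i} → x ∈ xs → x′ ∈ xs → i < k → index x i ≡ index x′ (c x′) → i ≡ c x
  index-injective {x} {x′} x∈ x′∈ i<k eq with colorIndex-injective i<k (c<k x′) eq
  ... | y≡y′ , i≡ = trans i≡ (cong c (sym (inj x∈ x′∈ y≡y′)))

  ∈us : ∀ {x i} → x ∈ xs → i < k → index x i ∈ us
  ∈us x∈ i<k = ∈-cartesianProductWith⁺ index x∈ (∈-downFrom⁺ i<k)

  -- The index of a wrong colour differs from every index used in `a`: hashing is injective on `xs`,
  -- so an equal index would come from the same x and thus carry its own colour.
  code-coprime : ∀ {x i} → x ∈ xs → i < k → i ≢ c x → Coprime (code x i) a
  code-coprime {x} {i} x∈ i<k i≢ = coprime-product codes coprime
    where
    coprime : ∀ {n} → n ∈ codes → Coprime (code x i) n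
    coprime n∈ with ∈-map⁻ _ n∈
    ... | x′ , x′∈ , refl = modulus-coprime {b} {index x i} {index x′ (c x′)}
      (∣discriminant us (∈us x∈ i<k) (∈us x′∈ (c<k x′)) (i≢ ∘ index-injective x∈ x′∈ i<k))

  code≢1 : ∀ x i → code x i ≢ 1
  code≢1 x i eq = ≢-nonZero⁻¹ (index x i * b)
    {{m*n≢0 (index x i) b {{index≢0}} {{discriminant-nonZero us}}}} (suc-injective eq)
    where
    index≢0 : NonZero (index x i)
    index≢0 = subst NonZero (sym (+-suc (x % m * k) i)) _

  code-sound : ∀ {x i} → x ∈ xs → i < k → code x i ∣ a → i ≡ c x
  code-sound {x} {i} x∈ i<k code∣a with i ≟ c x
  ... | yes i≡ = i≡
  ... | no  i≢ = contradiction (code-coprime x∈ i<k i≢ (∣-refl , code∣a)) (code≢1 x i)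

-- With Q = r ! T for the largest T that keeps a ≤ t, the hash modulus m is at
-- most 1 + r Q, so b and a are at most a fixed power G ^ E of G ≈ r Q k, whereas
-- t < Q ^ (2 E).  The discriminant of xs is then less than (1 + Q) ^ r.
module Encoding (k ℓ r E : ℕ) {{_ : NonZero k}} {{_ : NonZero r}} {{_ : NonZero E}}
  (E≥ : suc (ℓ * k * (ℓ * k)) * suc ℓ ≤ E) (r> : 2 * E * (ℓ * ℓ) < r)
  {t : ℕ} (xs : List ℕ) (len : length xs ≤ ℓ) (xs≤t : ∀ {x} → x ∈ xs → x ≤ t)
  (c : ℕ → ℕ) (c<k : ∀ x → c x < k) where

  open Scale k r E

  discriminant-< : ∀ T → T₀ ≤ T → 1 ≤ t → t < limit (suc T) ^ E → discriminant xs < suc (r ! * T) ^ r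
  discriminant-< T T₀≤T 1≤t t<G = begin-strict
    discriminant xs            ≤⟨ discriminant-≤ xs {e = ℓ} 1≤t xs≤t len ⟩
    t ^ (ℓ * ℓ)                ≤⟨ ^-monoˡ-≤ (ℓ * ℓ) (<⇒≤ t<G) ⟩
    (limit (suc T) ^ E) ^ (ℓ * ℓ)
      ≤⟨ ^-monoˡ-≤ (ℓ * ℓ) (^-monoˡ-≤ E (limit-suc-≤ T T₀≤T)) ⟩
    ((Q * Q) ^ E) ^ (ℓ * ℓ)
      ≡⟨ cong (λ q → ((Q * q) ^ E) ^ (ℓ * ℓ)) (*-identityʳ Q) ⟨
    ((Q ^ 2) ^ E) ^ (ℓ * ℓ)    ≡⟨ cong (_^ (ℓ * ℓ)) (^-*-assoc Q 2 E) ⟩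
    (Q ^ (2 * E)) ^ (ℓ * ℓ)    ≡⟨ ^-*-assoc Q (2 * E) (ℓ * ℓ) ⟩
    Q ^ (2 * E * (ℓ * ℓ))      ≤⟨ ^-monoˡ-≤ (2 * E * (ℓ * ℓ)) (n≤1+n Q) ⟩
    suc Q ^ (2 * E * (ℓ * ℓ))  <⟨ ^-monoʳ-< (suc Q) (s≤s 1≤Q) r> ⟩
    suc Q ^ r                  ∎
    where
    open ≤-Reasoning
    Q = r ! * T
    1≤Q : 1 ≤ Q
    1≤Q = *-mono-≤ (>-nonZero⁻¹ (r !) {{r !≢0}}) (≤-trans (s≤s z≤n) T₀≤T)

  encode-mod : ∀ m {{_ : NonZero m}} M → m ≤ M → InjectiveMod xs m → suc (M * k) ^ E ≤ t →
    ∃ λ b → ∃ λ a → Encodes k t xs c m b a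
  encode-mod m M m≤M inj G^E≤t = b , a , record
    { m≤t        = ≤-trans (≤-trans m≤M (m≤m*n M k)) B≤t
    ; b≤t        = ≤t (<⇒≤ suc-e≤E) b≤
    ; a≤t        = ≤t (≤-trans (*-monoʳ-≤ (suc e) (n≤1+n ℓ)) E≥) a≤
    ; code≤t     = λ {x} x∈ i<k → ≤t suc-e≤E (code≤ x i<k)
    ; index≤t    = λ {x} x∈ i<k → ≤-trans (index≤B x i<k) B≤t
    ; code-color = code-color
    ; code-sound = code-sound
    }
    where
    open Codes k ℓ m M m≤M xs len inj c c<k
    ≤t : ∀ {i n} → i ≤ E → n ≤ G ^ i → n ≤ t
    ≤t i≤E n≤ = ≤-trans n≤ (≤-trans (^-monoʳ-≤ G i≤E) G^E≤t)
    -- The factor `suc ℓ` in place of ℓ leaves room for `b` and for a single code even when ℓ is 0.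
    suc-e≤E : suc e ≤ E
    suc-e≤E = ≤-trans (m≤m*n (suc e) (suc ℓ)) E≥
    B≤t : B ≤ t
    B≤t = ≤-trans (n≤1+n B) (≤t (>-nonZero⁻¹ E) (≤-reflexive (sym (^-identityʳ G))))

  encode : limit T₀ ^ E ≤ t → ∃ λ m → ∃ λ b → ∃ λ a → Encodes k t xs c m b a
  encode thr≤t with scale thr≤t
  ... | T , T₀≤T , G≤t , t<G
    with nondivisor r (r ! * T) (m∣m*n T) (discriminant xs) {{discriminant-nonZero xs}}
           (discriminant-< T T₀≤T (≤-trans (m^n>0 (limit T) E) G≤t) t<G)
  ... | j , j<r , ∤D = modulus (r ! * T) (suc j) , encode-mod
    (modulus (r ! * T) (suc j)) (suc (r * (r ! * T))) (s≤s (*-monoˡ-≤ (r ! * T) j<r))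
    (injectiveMod xs _ ∤D) G≤t

-- `N` precedes t, the elements and the colours, because φ′ is built from it before any structure is
-- given.
Encodable : (k ℓ : ℕ) → Set
Encodable k ℓ = ∃ λ N → ∀ {t} → N ≤ t →
  (xs : List ℕ) → length xs ≤ ℓ → (∀ {x} → x ∈ xs → x ≤ t) →
  (c : ℕ → ℕ) → (∀ x → c x < k) → ∃ λ m → ∃ λ b → ∃ λ a → Encodes k t xs c m b a

encodable-with : ∀ k ℓ r E {{_ : NonZero k}} {{_ : NonZero r}} {{_ : NonZero E}} →
  suc (ℓ * k * (ℓ * k)) * suc ℓ ≤ E → 2 * E * (ℓ * ℓ) < r → Encodable k ℓ
encodable-with k ℓ r E E≥ r> = Scale.limit k r E (Scale.T₀ k r E) ^ E ,
  λ N≤t xs len xs≤t c c<k → Encoding.encode k ℓ r E E≥ r> xs len xs≤t c c<k N≤t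

-- The threshold is astronomical; it must never be evaluated.
abstract
  encodable : ∀ k ℓ {{_ : NonZero k}} → Encodable k ℓ
  encodable k ℓ =
    let E = suc (ℓ * k * (ℓ * k)) * suc ℓ
    in  encodable-with k ℓ (suc (2 * E * (ℓ * ℓ))) E ≤-refl ≤-refl

-- Satisfaction and colourings

¬-⇔ : ∀ {A B : Set} → A ⇔ B → (¬ A) ⇔ (¬ B)
¬-⇔ A⇔B = mk⇔ (_∘ from A⇔B) (_∘ to A⇔B)

∃-⇔ : ∀ {A : Set} {P Q : A → Set} → (∀ a → P a ⇔ Q a) → ∃ P ⇔ ∃ Q
∃-⇔ P⇔Q = mk⇔ (map₂ (to (P⇔Q _))) (map₂ (from (P⇔Q _)))

∀-⇔ : ∀ {A : Set} {P Q : A → Set} → (∀ a → P a ⇔ Q a) → (∀ a → P a) ⇔ (∀ a → Q a)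
∀-⇔ P⇔Q = mk⇔ (λ p a → to (P⇔Q a) (p a)) (λ q a → from (P⇔Q a) (q a))

≡⇒⇔ : ∀ {A : Set} (P : A → Set) {x y} → x ≡ y → P x ⇔ P y
≡⇒⇔ P x≡y = mk⇔ (subst P x≡y) (subst P (sym x≡y))

module _ {σ : Signature} (A : Structure σ) where
  open Structure A

  private
    variable
      ρ ρ′ : ℕ → Carrier

  mutual
    eval-agree : ∀ t → (∀ x → OccursInTerm x t → ρ x ≡ ρ′ x) → eval A ρ t ≡ eval A ρ′ t
    eval-agree (var x)    agree = agree x refl
    eval-agree (fun f ts) agree = cong (⟦fun⟧ f) (evals-agree ts agree)

    evals-agree : ∀ {n} (ts : Vec (Term σ) n) → (∀ x → OccursInTerms x ts → ρ x ≡ ρ′ x) →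
      evals A ρ ts ≡ evals A ρ′ ts
    evals-agree []       agree = refl
    evals-agree (t ∷ ts) agree =
      cong₂ _∷_ (eval-agree t (λ x → agree x ∘ inj₁)) (evals-agree ts (λ x → agree x ∘ inj₂))

  update-agree : ∀ y a x → (x ≢ y → ρ x ≡ ρ′ x) → _[_↦_] A ρ y a x ≡ _[_↦_] A ρ′ y a x
  update-agree y a x agree with y ≡ᵇ x in eq
  ... | true  = refl
  ... | false = agree λ x≡y → subst T eq (≡⇒≡ᵇ y x (sym x≡y))

  sat-agree : ∀ φ → (∀ x → FreeIn x φ → ρ x ≡ ρ′ x) → Sat A ρ φ ⇔ Sat A ρ′ φ
  sat-agree (s ≐ t)    agree = ≡⇒⇔ (λ (a , b) → a ≡ b)
    (cong₂ _,_ (eval-agree s (λ x → agree x ∘ inj₁)) (eval-agree t (λ x → agree x ∘ inj₂)))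
  sat-agree (rel R ts) agree = ≡⇒⇔ (T ∘ ⟦rel⟧ R) (evals-agree ts agree)
  sat-agree (¬′ φ)     agree = ¬-⇔ (sat-agree φ agree)
  sat-agree (φ ∧′ ψ)   agree =
    sat-agree φ (λ x → agree x ∘ inj₁) ×-⇔ sat-agree ψ (λ x → agree x ∘ inj₂)
  sat-agree (φ ∨′ ψ)   agree =
    sat-agree φ (λ x → agree x ∘ inj₁) ⊎-⇔ sat-agree ψ (λ x → agree x ∘ inj₂)
  sat-agree {ρ} {ρ′} (∃′ y φ) agree = ∃-⇔ λ a →
    sat-agree φ λ x free → update-agree {ρ = ρ} {ρ′} y a x λ x≢y → agree x (x≢y , free)
  sat-agree {ρ} {ρ′} (∀′ y φ) agree = ∀-⇔ λ a →
    sat-agree φ λ x free → update-agree {ρ = ρ} {ρ′} y a x λ x≢y → agree x (x≢y , free)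

  sentence-⊨ : ∀ φ → IsSentence φ → Sat A ρ φ → A ⊨ φ
  sentence-⊨ φ sentence sat ρ′ =
    to (sat-agree φ (λ x free → contradiction free (sentence x))) sat

  private
    index = proj₂ finite

  _≟ᶜ_ : (x y : Carrier) → Dec (x ≡ y)
  _≟ᶜ_ = via-injection (↔⇒↣ index) Fin._≟_

  any-element? : ∀ {P : Carrier → Set} → (∀ a → Dec (P a)) → Dec (∃ P)
  any-element? {P} P? = map′
    (λ (i , p) → Inverse.from index i , p)
    (λ (a , p) → Inverse.to index a , subst P (sym (Inverse.strictlyInverseʳ index a)) p)
    (Fin.any? (P? ∘ Inverse.from index))

  all-elements? : ∀ {P : Carrier → Set} → (∀ a → Dec (P a)) → Dec (∀ a → P a)
  all-elements? {P} P? = map′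
    (λ p a → subst P (Inverse.strictlyInverseʳ index a) (p (Inverse.to index a)))
    (λ p i → p (Inverse.from index i))
    (Fin.all? (P? ∘ Inverse.from index))

  sat? : ∀ ρ φ → Dec (Sat A ρ φ)
  sat? ρ (s ≐ t)    = eval A ρ s ≟ᶜ eval A ρ t
  sat? ρ (rel R ts) = T? (⟦rel⟧ R (evals A ρ ts))
  sat? ρ (¬′ φ)     = ¬? (sat? ρ φ)
  sat? ρ (φ ∧′ ψ)   = sat? ρ φ ×-dec sat? ρ ψ
  sat? ρ (φ ∨′ ψ)   = sat? ρ φ ⊎-dec sat? ρ ψ
  sat? ρ (∃′ x φ)   = any-element? λ a → sat? (_[_↦_] A ρ x a) φ
  sat? ρ (∀′ x φ)   = all-elements? λ a → sat? (_[_↦_] A ρ x a) φ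

module _ {τ : Signature} {k : ℕ} (A : Structure τ) (c : Structure.Carrier A → Fin k) where
  open Structure A

  paintedRel : ∀ {n} → ColorRel τ k n → Vec Carrier n → Bool
  paintedRel (base R)  xs       = ⟦rel⟧ R xs
  paintedRel (color i) (x ∷ []) = ⌊ c x Fin.≟ i ⌋

  paint : Structure (τ colors k)
  paint = record { Carrier = Carrier ; finite = finite ; ⟦rel⟧ = paintedRel ; ⟦fun⟧ = ⟦fun⟧ }

  paint-isColoring : IsColoring k A paint
  paint-isColoring = record
    { restricts = refl
    ; partition = λ x → c x , fromWitness {a? = c x Fin.≟ c x} refl , toWitness
    }

module Repaint {τ : Signature} {k : ℕ} (B : Structure (τ colors k))
  (c : Structure.Carrier B → Fin k) where
  open Structure B

  B′ : Structure (τ colors k)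
  B′ = paint (reduct B) c

  mutual
    eval-paint : ∀ ρ t → eval B ρ t ≡ eval B′ ρ t
    eval-paint ρ (var x)    = refl
    eval-paint ρ (fun f ts) = cong (⟦fun⟧ f) (evals-paint ρ ts)

    evals-paint : ∀ {n} ρ (ts : Vec (Term (τ colors k)) n) → evals B ρ ts ≡ evals B′ ρ ts
    evals-paint ρ []       = refl
    evals-paint ρ (t ∷ ts) = cong₂ _∷_ (eval-paint ρ t) (evals-paint ρ ts)

  sat-paint : ∀ ρ φ → (∀ i → ¬ OccursColor i φ) → Sat B ρ φ ⇔ Sat B′ ρ φ
  sat-paint ρ (s ≐ t)            _   =
    ≡⇒⇔ (λ (a , b) → a ≡ b) (cong₂ _,_ (eval-paint ρ s) (eval-paint ρ t))
  sat-paint ρ (rel (base R) ts)  _   = ≡⇒⇔ (T ∘ ⟦rel⟧ (base R)) (evals-paint ρ ts)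
  sat-paint ρ (rel (color i) ts) noc = contradiction refl (noc i)
  sat-paint ρ (¬′ φ)             noc = ¬-⇔ (sat-paint ρ φ noc)
  sat-paint ρ (φ ∧′ ψ)           noc =
    sat-paint ρ φ (λ i → noc i ∘ inj₁) ×-⇔ sat-paint ρ ψ (λ i → noc i ∘ inj₂)
  sat-paint ρ (φ ∨′ ψ)           noc =
    sat-paint ρ φ (λ i → noc i ∘ inj₁) ⊎-⇔ sat-paint ρ ψ (λ i → noc i ∘ inj₂)
  sat-paint ρ (∃′ x φ)           noc = ∃-⇔ λ a → sat-paint _ φ noc
  sat-paint ρ (∀′ x φ)           noc = ∀-⇔ λ a → sat-paint _ φ noc

-- Witnesses inspect few colours

colorAtoms : ∀ {τ k} → Formula (τ colors k) → ℕ
colorAtoms (s ≐ t)            = 0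
colorAtoms (rel (base R) ts)  = 0
colorAtoms (rel (color i) ts) = 1
colorAtoms (¬′ φ)             = colorAtoms φ
colorAtoms (φ ∧′ ψ)           = colorAtoms φ + colorAtoms ψ
colorAtoms (φ ∨′ ψ)           = colorAtoms φ + colorAtoms ψ
colorAtoms (∃′ x φ)           = colorAtoms φ
colorAtoms (∀′ x φ)           = colorAtoms φ

module _ {τ : Signature} {k : ℕ} (B : Structure (τ colors k)) where
  open Structure B

  -- An equivalence, because negated colour atoms have to transfer as well.
  ColorAt : (Carrier → Fin k) → Carrier → Set
  ColorAt c x = ∀ i → T (⟦rel⟧ (color i) (x ∷ [])) ⇔ T ⌊ c x Fin.≟ i ⌋

  -- A witness of φ inspects the colours of boundedly many elements only, because
  -- no colour atom is evaluated for all values of a variable.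
  Supported : (ℕ → Carrier) → Formula (τ colors k) → ℕ → Set
  Supported ρ φ ℓ = ∃ λ X → length X ≤ ℓ ×
    (∀ c → (∀ {x} → x ∈ X → ColorAt c x) → Sat (paint (reduct B) c) ρ φ)

  -- Induction along a witness: ∃ and ∨ follow the choice made, ∧ joins two supports. With negations
  -- only at atoms no ∃ is a ∀ in disguise, and a genuine ∀ is free of colours, so it survives every
  -- repainting with empty support.
  supported : ∀ ρ φ → NNF φ → NoColorUnder∀ φ → Sat B ρ φ → Supported ρ φ (colorAtoms φ)
  supported ρ (s ≐ t) _ _ sat =
    [] , z≤n , λ c _ → to (Repaint.sat-paint B c ρ (s ≐ t) λ _ ()) sat
  supported ρ (rel (base R) ts) _ _ sat =
    [] , z≤n , λ c _ → to (Repaint.sat-paint B c ρ (rel (base R) ts) λ _ ()) sat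
  supported ρ (rel (color i) (t ∷ [])) _ _ sat =
    [ eval B ρ t ] , ≤-refl , λ c at →
      subst (λ x → T ⌊ c x Fin.≟ i ⌋) (Repaint.eval-paint B c ρ t) (to (at (here refl) i) sat)
  supported ρ (¬′ _) (s ≐ t) _ sat =
    [] , z≤n , λ c _ → to (Repaint.sat-paint B c ρ (¬′ (s ≐ t)) λ _ ()) sat
  supported ρ (¬′ _) (rel (base R) ts) _ sat =
    [] , z≤n , λ c _ → to (Repaint.sat-paint B c ρ (¬′ (rel (base R) ts)) λ _ ()) sat
  supported ρ (¬′ _) (rel (color i) (t ∷ [])) _ sat =
    [ eval B ρ t ] , ≤-refl , λ c at →
      subst (λ x → ¬ T ⌊ c x Fin.≟ i ⌋) (Repaint.eval-paint B c ρ t) (sat ∘ from (at (here refl) i))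
  supported ρ (φ ∧′ ψ) (nφ , nψ) (cφ , cψ) (satφ , satψ)
    with supported ρ φ nφ cφ satφ | supported ρ ψ nψ cψ satψ
  ... | X , lenX , onX | Y , lenY , onY =
    X ++ Y , ≤-trans (≤-reflexive (length-++ X)) (+-mono-≤ lenX lenY) ,
    λ c at → onX c (at ∘ ∈-++⁺ˡ) , onY c (at ∘ ∈-++⁺ʳ X)
  supported ρ (φ ∨′ ψ) (nφ , _) (cφ , _) (inj₁ satφ) with supported ρ φ nφ cφ satφ
  ... | X , lenX , onX = X , ≤-trans lenX (m≤m+n _ _) , λ c at → inj₁ (onX c at)
  supported ρ (φ ∨′ ψ) (_ , nψ) (_ , cψ) (inj₂ satψ) with supported ρ ψ nψ cψ satψ
  ... | X , lenX , onX = X , ≤-trans lenX (m≤n+m _ _) , λ c at → inj₂ (onX c at)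
  supported ρ (∃′ x φ) nφ cφ (a , sat) with supported _ φ nφ cφ sat
  ... | X , lenX , onX = X , lenX , λ c at → a , onX c at
  supported ρ (∀′ x φ) _ noc sat =
    [] , z≤n , λ c _ → to (Repaint.sat-paint B c ρ (∀′ x φ) noc) sat

-- The variables of φ are shifted by 12.  Below 12, variable 0 holds the element
-- whose colour is asked for, 1, 2 and 3 the parameters of the colouring, and the
-- others are local to the colour formulas.
module Translate {τ : Signature} {k : ℕ} (ψ : Fin k → Formula τ) where

  mutual
    term : Term (τ colors k) → Term τ
    term (var x)    = var (12 + x)
    term (fun f ts) = fun f (terms ts)

    terms : ∀ {n} → Vec (Term (τ colors k)) n → Vec (Term τ) n
    terms []       = []
    terms (t ∷ ts) = term t ∷ terms ts

  translate : Formula (τ colors k) → Formula τ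
  translate (s ≐ t)                  = term s ≐ term t
  translate (rel (base R) ts)        = rel R (terms ts)
  -- Naming the argument instead of substituting it lets all colour formulas share the same
  -- variables, at the price of one quantifier. `term t` has only variables from 12 on, so nothing
  -- is captured.
  translate (rel (color i) (t ∷ [])) = ∃′ 0 (var 0 ≐ term t ∧′ ψ i)
  translate (¬′ φ)                   = ¬′ translate φ
  translate (φ ∧′ χ)                 = translate φ ∧′ translate χ
  translate (φ ∨′ χ)                 = translate φ ∨′ translate χ
  translate (∃′ x φ)                 = ∃′ (12 + x) (translate φ)
  translate (∀′ x φ)                 = ∀′ (12 + x) (translate φ)

  module _ (A : Structure τ) (col : (p q r : Structure.Carrier A) → Structure.Carrier A → Fin k)
    (ψ-sem : ∀ ρ i → Sat A ρ (ψ i) ⇔ col (ρ 1) (ρ 2) (ρ 3) (ρ 0) ≡ i) where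
    open Structure A

    mutual
      eval-term : ∀ {c : Carrier → Fin k} ρ t → eval A ρ (term t) ≡ eval (paint A c) (ρ ∘ (12 +_)) t
      eval-term ρ (var x)    = refl
      eval-term ρ (fun f ts) = cong (⟦fun⟧ f) (evals-terms ρ ts)

      evals-terms : ∀ {c : Carrier → Fin k} {n} ρ (ts : Vec (Term (τ colors k)) n) →
        evals A ρ (terms ts) ≡ evals (paint A c) (ρ ∘ (12 +_)) ts
      evals-terms ρ []       = refl
      evals-terms ρ (t ∷ ts) = cong₂ _∷_ (eval-term ρ t) (evals-terms ρ ts)

    painting : (ℕ → Carrier) → Structure (τ colors k)
    painting ρ = paint A (col (ρ 1) (ρ 2) (ρ 3))

    sat-translate : ∀ ρ φ → Sat A ρ (translate φ) ⇔ Sat (painting ρ) (ρ ∘ (12 +_)) φ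
    sat-translate ρ (s ≐ t) =
      ≡⇒⇔ (λ (a , b) → a ≡ b) (cong₂ _,_ (eval-term ρ s) (eval-term ρ t))
    sat-translate ρ (rel (base R) ts) = ≡⇒⇔ (T ∘ ⟦rel⟧ R) (evals-terms ρ ts)
    sat-translate ρ (rel (color i) (t ∷ [])) = mk⇔
      (λ (a , a≡t , sat) → fromWitness (trans
        (cong (col (ρ 1) (ρ 2) (ρ 3)) (sym (trans a≡t (eval-term (_[_↦_] A ρ 0 a) t))))
        (to (ψ-sem (_[_↦_] A ρ 0 a) i) sat)))
      (λ colored → let a = eval (painting ρ) (ρ ∘ (12 +_)) t in
        a , sym (eval-term (_[_↦_] A ρ 0 a) t) , from (ψ-sem (_[_↦_] A ρ 0 a) i) (toWitness colored))
    sat-translate ρ (¬′ φ)   = ¬-⇔ (sat-translate ρ φ)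
    sat-translate ρ (φ ∧′ χ) = sat-translate ρ φ ×-⇔ sat-translate ρ χ
    sat-translate ρ (φ ∨′ χ) = sat-translate ρ φ ⊎-⇔ sat-translate ρ χ
    -- An update at 12 + x becomes, by computation, an update at x of the shifted assignment, and it
    -- leaves the parameters in 1, 2 and 3 alone.
    sat-translate ρ (∃′ x φ) = ∃-⇔ λ a → sat-translate (_[_↦_] A ρ (12 + x) a) φ
    sat-translate ρ (∀′ x φ) = ∀-⇔ λ a → sat-translate (_[_↦_] A ρ (12 + x) a) φ

-- Counting free variables, quantifier rank and bound variables

record FreeBelow {σ : Signature} (n : ℕ) (χ : Formula σ) : Set where
  constructor freeBelow
  field
    free< : ∀ x → FreeIn x χ → x < n

open FreeBelow

record ColorFormula {σ : Signature} (χ : Formula σ) : Set where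
  field
    free<4  : FreeBelow 4 χ
    qr≤8    : qr χ ≤ 8
    bound<12 : All (_< 12) (quantifiedVars χ)

-- Variable 0 is never free, since the translated colour atom binds it; 9 is that binder plus the
-- rank 8 of a colour formula. Lower bounds are kept because the theorem bounds absolute
-- differences.
record Simulates {σ τ : Signature} (φ : Formula σ) (χ : Formula τ) : Set where
  field
    free     : ∀ x → FreeIn x χ → (0 < x × x < 4) ⊎ ∃ λ y → x ≡ 12 + y × FreeIn y φ
    qr-lower : qr φ ≤ qr χ
    qr-upper : qr χ ≤ 9 + qr φ
    bound⊆   : ∀ {x} → x ∈ quantifiedVars χ → x < 12 ⊎ ∃ λ y → x ≡ 12 + y × y ∈ quantifiedVars φ
    ⊆bound   : ∀ {y} → y ∈ quantifiedVars φ → 12 + y ∈ quantifiedVars χ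

open ColorFormula
open Simulates

closure : ∀ {τ} → Formula τ → Formula τ
closure χ = ∃′ 1 (∃′ 2 (∃′ 3 χ))

module _ {σ τ : Signature} {φ φ′ : Formula σ} {χ χ′ : Formula τ} where

  simulates-∧ : Simulates φ χ → Simulates φ′ χ′ → Simulates (φ ∧′ φ′) (χ ∧′ χ′)
  simulates-∧ s s′ = record
    { free = λ where
        x (inj₁ f) → map-⊎₂ (λ (y , eq , f) → y , eq , inj₁ f) (free s x f)
        x (inj₂ f) → map-⊎₂ (λ (y , eq , f) → y , eq , inj₂ f) (free s′ x f)
    ; qr-lower = ⊔-mono-≤ (qr-lower s) (qr-lower s′)
    ; qr-upper = ≤-trans (⊔-mono-≤ (qr-upper s) (qr-upper s′))
        (≤-reflexive (sym (+-distribˡ-⊔ 9 (qr φ) (qr φ′))))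
    ; bound⊆ = λ x∈ → [ map-⊎₂ (λ (y , eq , y∈) → y , eq , ∈-++⁺ˡ y∈) ∘ bound⊆ s
                      , map-⊎₂ (λ (y , eq , y∈) → y , eq , ∈-++⁺ʳ _ y∈) ∘ bound⊆ s′ ]′
                      (∈-++⁻ (quantifiedVars χ) x∈)
    ; ⊆bound = λ y∈ → [ ∈-++⁺ˡ ∘ ⊆bound s , ∈-++⁺ʳ _ ∘ ⊆bound s′ ]′ (∈-++⁻ (quantifiedVars φ) y∈)
    }

  simulates-∨ : Simulates φ χ → Simulates φ′ χ′ → Simulates (φ ∨′ φ′) (χ ∨′ χ′)
  simulates-∨ s s′ = record
    { free = free s∧s′ ; qr-lower = qr-lower s∧s′ ; qr-upper = qr-upper s∧s′
    ; bound⊆ = bound⊆ s∧s′ ; ⊆bound = ⊆bound s∧s′ }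
    where s∧s′ = simulates-∧ s s′

module _ {σ τ : Signature} {φ : Formula σ} {χ : Formula τ} (s : Simulates φ χ) where

  simulates-¬ : Simulates (¬′ φ) (¬′ χ)
  simulates-¬ = record
    { free = free s ; qr-lower = qr-lower s ; qr-upper = qr-upper s
    ; bound⊆ = bound⊆ s ; ⊆bound = ⊆bound s }

  simulates-∃ : ∀ x → Simulates (∃′ x φ) (∃′ (12 + x) χ)
  simulates-∃ x = record
    { free = λ z (z≢ , f) →
        map-⊎₂ (λ (y , eq , f) → y , eq , (λ y≡x → z≢ (trans eq (cong (12 +_) y≡x))) , f) (free s z f)
    ; qr-lower = s≤s (qr-lower s)
    ; qr-upper = s≤s (qr-upper s)
    ; bound⊆ = λ where
        (here refl) → inj₂ (x , refl , here refl)
        (there z∈)  → map-⊎₂ (λ (y , eq , y∈) → y , eq , there y∈) (bound⊆ s z∈)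
    ; ⊆bound = λ where
        (here refl) → here refl
        (there y∈)  → there (⊆bound s y∈)
    }

  simulates-∀ : ∀ x → Simulates (∀′ x φ) (∀′ (12 + x) χ)
  simulates-∀ x = record
    { free = free s∃ ; qr-lower = qr-lower s∃ ; qr-upper = qr-upper s∃
    ; bound⊆ = bound⊆ s∃ ; ⊆bound = ⊆bound s∃ }
    where s∃ = simulates-∃ x

  simulates-either : ∀ {χ′} → Simulates φ χ′ → Simulates φ (χ ∨′ χ′)
  simulates-either {χ′} s′ = record
    { free = λ where
        x (inj₁ f) → free s x f
        x (inj₂ f) → free s′ x f
    ; qr-lower = ≤-trans (qr-lower s) (m≤m⊔n (qr χ) (qr χ′))
    ; qr-upper = ⊔-lub (qr-upper s) (qr-upper s′)
    ; bound⊆ = [ bound⊆ s , bound⊆ s′ ]′ ∘ ∈-++⁻ (quantifiedVars χ)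
    ; ⊆bound = ∈-++⁺ˡ ∘ ⊆bound s
    }

  -- For k = 0 a false sentence is wanted. A bare contradiction would lose the rank and the bound
  -- variables of φ; the conjunct χ preserves them.
  simulates-never : Simulates φ (χ ∧′ ¬′ (var 1 ≐ var 1))
  simulates-never = record
    { free = λ where
        x (inj₁ f)                  → free s x f
        x (inj₂ (inj₁ refl)) → inj₁ (s≤s z≤n , s≤s (s≤s z≤n))
        x (inj₂ (inj₂ refl)) → inj₁ (s≤s z≤n , s≤s (s≤s z≤n))
    ; qr-lower = ≤-trans (qr-lower s) (m≤m⊔n (qr χ) 0)
    ; qr-upper = ⊔-lub (qr-upper s) z≤n
    ; bound⊆ = [ bound⊆ s , (λ ()) ]′ ∘ ∈-++⁻ (quantifiedVars χ)
    ; ⊆bound = ∈-++⁺ˡ ∘ ⊆bound s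
    }

  closure-sentence : IsSentence φ → IsSentence (closure χ)
  closure-sentence sentence x (x≢1 , x≢2 , x≢3 , f) with free s x f
  ... | inj₂ (y , _ , fy) = sentence y fy
  closure-sentence sentence 1 (x≢1 , _) | inj₁ _ = x≢1 refl
  closure-sentence sentence 2 (_ , x≢2 , _) | inj₁ _ = x≢2 refl
  closure-sentence sentence 3 (_ , _ , x≢3 , _) | inj₁ _ = x≢3 refl
  closure-sentence sentence (suc (suc (suc (suc _)))) _ | inj₁ (_ , s≤s (s≤s (s≤s (s≤s ()))))

∣-∣-≤ : ∀ {m n c} → m ≤ n → n ≤ c + m → ∣ n - m ∣ ≤ c
∣-∣-≤ {m} {n} {c} m≤n n≤c+m = begin
  ∣ n - m ∣    ≡⟨ m≤n⇒∣n-m∣≡n∸m m≤n ⟩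
  n ∸ m        ≤⟨ ∸-monoˡ-≤ m n≤c+m ⟩
  c + m ∸ m    ≡⟨ m+n∸n≡m c m ⟩
  c            ∎
  where open ≤-Reasoning

-- Removing one occurrence of the head from `ys` keeps the tail inside, as the head does not recur
-- in the tail.
unique-⊆⇒length-≤ : ∀ {A : Set} {xs ys : List A} → Unique xs → (∀ {x} → x ∈ xs → x ∈ ys) →
  length xs ≤ length ys
unique-⊆⇒length-≤ []                     _     = z≤n
unique-⊆⇒length-≤ {xs = x ∷ xs} (x∉xs ∷ xs!) xs⊆ys with ∈-∃++ (xs⊆ys (here refl))
... | ys₁ , ys₂ , refl = begin
  suc (length xs)             ≤⟨ s≤s (unique-⊆⇒length-≤ xs! xs⊆) ⟩
  suc (length (ys₁ ++ ys₂))   ≡⟨ cong suc (length-++ ys₁) ⟩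
  suc (length ys₁ + length ys₂)  ≡⟨ +-suc (length ys₁) (length ys₂) ⟨
  length ys₁ + length (x ∷ ys₂)  ≡⟨ length-++ ys₁ ⟨
  length (ys₁ ++ x ∷ ys₂)     ∎
  where
  open ≤-Reasoning
  xs⊆ : ∀ {y} → y ∈ xs → y ∈ ys₁ ++ ys₂
  xs⊆ y∈ with ∈-++⁻ ys₁ (xs⊆ys (there y∈))
  ... | inj₁ y∈ys₁         = ∈-++⁺ˡ y∈ys₁
  ... | inj₂ (there y∈ys₂) = ∈-++⁺ʳ ys₁ y∈ys₂
  ... | inj₂ (here refl)   = contradiction refl (All.lookup x∉xs y∈)

module _ {σ τ : Signature} {φ : Formula σ} {χ : Formula τ} (s : Simulates φ χ) where

  closure-qr : ∣ qr (closure χ) - qr φ ∣ ≤ 12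
  closure-qr = ∣-∣-≤ (≤-trans (qr-lower s) (m≤n+m (qr χ) 3)) (+-monoʳ-≤ 3 (qr-upper s))

  -- The bound variables of φ reappear injectively shifted by 12, and all others lie among 0 to 11.
  closure-bound : ∣ length (bound (closure χ)) - length (bound φ) ∣ ≤ 12
  closure-bound = ∣-∣-≤
    (begin
      length (bound φ)                  ≡⟨ length-map (12 +_) (bound φ) ⟨
      length (map (12 +_) (bound φ))
        ≤⟨ unique-⊆⇒length-≤
             (unique-map⁺ (+-cancelˡ-≡ 12 _ _) (deduplicate-! _≟_ (quantifiedVars φ))) lower ⟩
      length (bound (closure χ))                 ∎)
    (begin
      length (bound (closure χ))
        ≤⟨ unique-⊆⇒length-≤ (deduplicate-! _≟_ (quantifiedVars (closure χ))) upper ⟩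
      length (upTo 12 ++ map (12 +_) (bound φ))
        ≡⟨ length-++ (upTo 12) {map (12 +_) (bound φ)} ⟩
      12 + length (map (12 +_) (bound φ))  ≡⟨ cong (12 +_) (length-map (12 +_) (bound φ)) ⟩
      12 + length (bound φ)             ∎)
    where
    open ≤-Reasoning
    lower : ∀ {x} → x ∈ map (12 +_) (bound φ) → x ∈ bound (closure χ)
    lower x∈ with ∈-map⁻ (12 +_) x∈
    ... | y , y∈ , refl = ∈-deduplicate⁺ _≟_ {xs = quantifiedVars (closure χ)}
      (there (there (there (⊆bound s (∈-deduplicate⁻ _≟_ (quantifiedVars φ) y∈)))))
    below : ∀ {x} → x < 12 → x ∈ upTo 12 ++ map (12 +_) (bound φ)
    below x<12 = ∈-++⁺ˡ (∈-upTo⁺ x<12)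
    upper′ : ∀ {x} → x ∈ quantifiedVars (closure χ) → x ∈ upTo 12 ++ map (12 +_) (bound φ)
    upper′ (here refl)                 = below (s≤s (s≤s z≤n))
    upper′ (there (here refl))         = below (s≤s (s≤s (s≤s z≤n)))
    upper′ (there (there (here refl))) = below (s≤s (s≤s (s≤s (s≤s z≤n))))
    upper′ (there (there (there x∈))) with bound⊆ s x∈
    ... | inj₁ x<12           = below x<12
    ... | inj₂ (y , refl , y∈) = ∈-++⁺ʳ (upTo 12) (∈-map⁺ (12 +_) (∈-deduplicate⁺ _≟_ y∈))
    upper : ∀ {x} → x ∈ bound (closure χ) → x ∈ upTo 12 ++ map (12 +_) (bound φ)
    upper = upper′ ∘ ∈-deduplicate⁻ _≟_ (quantifiedVars (closure χ))

module _ {τ : Signature} {k : ℕ} (ψ : Fin k → Formula τ) (ψ-ok : ∀ i → ColorFormula (ψ i)) where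
  open Translate ψ

  mutual
    occurs-term : ∀ {x} t → OccursInTerm x (term t) → ∃ λ y → x ≡ 12 + y × OccursInTerm y t
    occurs-term (var y)    refl = y , refl , refl
    occurs-term (fun f ts) occ  = occurs-terms ts occ

    occurs-terms : ∀ {x n} (ts : Vec (Term (τ colors k)) n) → OccursInTerms x (terms ts) →
      ∃ λ y → x ≡ 12 + y × OccursInTerms y ts
    occurs-terms (t ∷ ts) (inj₁ occ) = map₂ (map₂ inj₁) (occurs-term t occ)
    occurs-terms (t ∷ ts) (inj₂ occ) = map₂ (map₂ inj₂) (occurs-terms ts occ)

  translate-simulates : ∀ φ → Simulates φ (translate φ)
  translate-simulates (s ≐ t) = record
    { free = λ where
        x (inj₁ occ) → inj₂ (map₂ (map₂ inj₁) (occurs-term s occ))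
        x (inj₂ occ) → inj₂ (map₂ (map₂ inj₂) (occurs-term t occ))
    ; qr-lower = z≤n ; qr-upper = z≤n ; bound⊆ = λ () ; ⊆bound = λ () }
  translate-simulates (rel (base R) ts) = record
    { free = λ x occ → inj₂ (occurs-terms ts occ)
    ; qr-lower = z≤n ; qr-upper = z≤n ; bound⊆ = λ () ; ⊆bound = λ () }
  translate-simulates (rel (color i) (t ∷ [])) = record
    { free = λ where
        x (x≢0 , inj₁ (inj₁ x≡0)) → contradiction x≡0 x≢0
        x (x≢0 , inj₁ (inj₂ occ)) → inj₂ (map₂ (map₂ inj₁) (occurs-term t occ))
        x (x≢0 , inj₂ f)          → inj₁ (n≢0⇒n>0 x≢0 , free< (free<4 (ψ-ok i)) x f)
    ; qr-lower = z≤n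
    ; qr-upper = s≤s (qr≤8 (ψ-ok i))
    ; bound⊆ = λ where
        (here refl) → inj₁ (s≤s z≤n)
        (there x∈)  → inj₁ (All.lookup (bound<12 (ψ-ok i)) x∈)
    ; ⊆bound = λ ()
    }
  translate-simulates (¬′ φ)   = simulates-¬ (translate-simulates φ)
  translate-simulates (φ ∧′ χ) = simulates-∧ (translate-simulates φ) (translate-simulates χ)
  translate-simulates (φ ∨′ χ) = simulates-∨ (translate-simulates φ) (translate-simulates χ)
  translate-simulates (∃′ x φ) = simulates-∃ (translate-simulates φ) x
  translate-simulates (∀′ x φ) = simulates-∀ (translate-simulates φ) x

-- Colour formulas and a total choice of colour

module _ {σ : Signature} {χ χ′ : Formula σ} where

  colorFormula-∧ : ColorFormula χ → ColorFormula χ′ → ColorFormula (χ ∧′ χ′)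
  colorFormula-∧ f f′ = record
    { free<4   = freeBelow λ x → [ free< (free<4 f) x , free< (free<4 f′) x ]′
    ; qr≤8     = ⊔-lub (qr≤8 f) (qr≤8 f′)
    ; bound<12 = ++⁺ (bound<12 f) (bound<12 f′)
    }

  colorFormula-∨ : ColorFormula χ → ColorFormula χ′ → ColorFormula (χ ∨′ χ′)
  colorFormula-∨ f f′ = record
    { free<4   = freeBelow (free< (free<4 f∧f′))
    ; qr≤8     = qr≤8 f∧f′
    ; bound<12 = bound<12 f∧f′
    }
    where f∧f′ = colorFormula-∧ f f′

colorFormula-¬ : ∀ {σ} {χ : Formula σ} → ColorFormula χ → ColorFormula (¬′ χ)
colorFormula-¬ f = record
  { free<4 = freeBelow (free< (free<4 f)) ; qr≤8 = qr≤8 f ; bound<12 = bound<12 f }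

colorFormula-≐ : ∀ {σ} {t : Term σ} → (∀ x → OccursInTerm x t → x < 4) → ColorFormula (var 0 ≐ t)
colorFormula-≐ t<4 = record
  { free<4 = freeBelow λ where
      x (inj₁ refl) → s≤s z≤n
      x (inj₂ occ)  → t<4 x occ
  ; qr≤8 = z≤n ; bound<12 = [] }

-- The last colour is an untested default, so each element receives exactly one colour even from
-- parameters that encode nothing.
firstColor : ∀ {n} {P : Fin (suc n) → Set} → (∀ i → Dec (P i)) → Fin (suc n)
firstColor {zero}  P? = zero
firstColor {suc n} P? with P? zero
... | yes _ = zero
... | no  _ = suc (firstColor (P? ∘ suc))

firstColor-unique : ∀ {n} {P : Fin (suc n) → Set} (P? : ∀ i → Dec (P i)) i →
  P i → (∀ j → P j → j ≡ i) → firstColor P? ≡ i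
firstColor-unique {zero}  P? zero _ _ = refl
firstColor-unique {suc n} P? i Pi unique with P? zero
firstColor-unique {suc n} P? i       Pi unique | yes P0 = unique zero P0
firstColor-unique {suc n} P? zero    Pi unique | no ¬P0 = contradiction Pi ¬P0
firstColor-unique {suc n} P? (suc i) Pi unique | no ¬P0 =
  cong suc (firstColor-unique (P? ∘ suc) i Pi (λ j Pj → Fin.suc-injective (unique (suc j) Pj)))

module _ {σ : Signature} where

  -- The colour classes of `firstColor` as formulas, with `var 0 ≐ var 0` for the default. Only
  -- Boolean connectives are added, so rank and variables stay bounded for any number of colours.
  first : ∀ {n} → (Fin (suc n) → Formula σ) → Fin (suc n) → Formula σ
  first {zero}  θ zero    = var 0 ≐ var 0
  first {suc n} θ zero    = θ zero
  first {suc n} θ (suc i) = ¬′ θ zero ∧′ first (θ ∘ suc) i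

  first-colorFormula : ∀ {n} (θ : Fin (suc n) → Formula σ) → (∀ i → ColorFormula (θ i)) →
    ∀ i → ColorFormula (first θ i)
  first-colorFormula {zero}  θ θ-ok zero    = colorFormula-≐ λ { x refl → s≤s z≤n }
  first-colorFormula {suc n} θ θ-ok zero    = θ-ok zero
  first-colorFormula {suc n} θ θ-ok (suc i) =
    colorFormula-∧ (colorFormula-¬ (θ-ok zero)) (first-colorFormula (θ ∘ suc) (θ-ok ∘ suc) i)

  sat-first : (A : Structure σ) → ∀ ρ {n} (θ : Fin (suc n) → Formula σ) i →
    Sat A ρ (first θ i) ⇔ firstColor (λ j → sat? A ρ (θ j)) ≡ i
  sat-first A ρ {zero}  θ zero = mk⇔ (λ _ → refl) (λ _ → refl)
  sat-first A ρ {suc n} θ i with sat? A ρ (θ zero)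
  sat-first A ρ {suc n} θ zero    | yes sat = mk⇔ (λ _ → refl) (λ _ → sat)
  sat-first A ρ {suc n} θ (suc i) | yes sat = mk⇔ (λ (¬sat , _) → contradiction sat ¬sat) (λ ())
  sat-first A ρ {suc n} θ zero    | no ¬sat = mk⇔ (λ sat → contradiction sat ¬sat) (λ ())
  sat-first A ρ {suc n} θ (suc i) | no ¬sat = mk⇔
    (λ (_ , sat) → cong suc (to (sat-first A ρ (θ ∘ suc) i) sat))
    (λ eq → ¬sat , from (sat-first A ρ (θ ∘ suc) i) (Fin.suc-injective eq))

module _ {τ : Signature} {k : ℕ} (A : Structure τ) (θ : Fin (suc k) → Formula τ) where
  open Structure A

  parameters : (p q r x : Carrier) → ℕ → Carrier
  parameters p q r x 0 = x
  parameters p q r x 1 = p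
  parameters p q r x 2 = q
  parameters p q r x _ = r

  colorOf : (p q r : Carrier) → Carrier → Fin (suc k)
  colorOf p q r x = firstColor λ i → sat? A (parameters p q r x) (θ i)

  sat-colorOf : (∀ i → ColorFormula (θ i)) →
    ∀ ρ i → Sat A ρ (first θ i) ⇔ colorOf (ρ 1) (ρ 2) (ρ 3) (ρ 0) ≡ i
  sat-colorOf θ-ok ρ i = ⇔-trans
    (sat-agree A (first θ i) λ x f → agree x (free< (free<4 (first-colorFormula θ θ-ok i)) x f))
    (sat-first A _ θ i)
    where
    agree : ∀ x → x < 4 → ρ x ≡ parameters (ρ 1) (ρ 2) (ρ 3) (ρ 0) x
    agree 0 _ = refl
    agree 1 _ = refl
    agree 2 _ = refl
    agree 3 _ = refl
    agree (suc (suc (suc (suc _)))) (s≤s (s≤s (s≤s (s≤s ()))))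

-- Arithmetic in finite structures

module _ {A : Set} {P Q : A → Bool} (P⇒Q : ∀ a → T (P a) → T (Q a)) where

  countᵇ-mono : ∀ {n} (xs : Vec A n) → countᵇ P xs ≤ countᵇ Q xs
  countᵇ-mono []       = z≤n
  countᵇ-mono (x ∷ xs) with P x | Q x | P⇒Q x
  ... | false | false | _   = countᵇ-mono xs
  ... | false | true  | _   = m≤n⇒m≤1+n (countᵇ-mono xs)
  ... | true  | true  | _   = s≤s (countᵇ-mono xs)
  ... | true  | false | imp = ⊥-elim (imp tt)

  countᵇ-strict : ∀ {a n} {xs : Vec A n} → a Vec.∈ xs → ¬ T (P a) → T (Q a) → countᵇ P xs < countᵇ Q xs
  countᵇ-strict {a} {xs = x ∷ xs} (here refl) ¬Pa Qa with P x | Q x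
  ... | false | true  = s≤s (countᵇ-mono xs)
  ... | true  | _     = contradiction tt ¬Pa
  countᵇ-strict {a} {xs = x ∷ xs} (there a∈) ¬Pa Qa with P x | Q x | P⇒Q x
  ... | false | false | _   = countᵇ-strict a∈ ¬Pa Qa
  ... | false | true  | _   = m≤n⇒m≤1+n (countᵇ-strict a∈ ¬Pa Qa)
  ... | true  | true  | _   = s≤s (countᵇ-strict a∈ ¬Pa Qa)
  ... | true  | false | imp = ⊥-elim (imp tt)

countᵇ-none : ∀ {A : Set} {P : A → Bool} → (∀ a → ¬ T (P a)) → ∀ {n} (xs : Vec A n) → countᵇ P xs ≡ 0
countᵇ-none         none []       = refl
countᵇ-none {P = P} none (x ∷ xs) with P x | none x
... | false | _  = countᵇ-none none xs
... | true  | ¬t = contradiction tt ¬t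

module Syntax {τ : Signature} (ar : Arithmetic τ) where
  open Arithmetic ar

  numeral : ℕ → Term τ
  numeral zero    = fun (Arithmetic.zero ar) []
  numeral (suc j) = fun succ (numeral j ∷ [])

  numeral-closed : ∀ j {x} → ¬ OccursInTerm x (numeral j)
  numeral-closed (suc j) (inj₁ occ) = numeral-closed j occ

  -- With variables 0, 1, 2, 3 for x, m, b, a: the modulus with index
  -- (x mod m) k + i + 1 divides a.
  hashed : ℕ → ℕ → Formula τ
  hashed k i = ∃′ 4 (∃′ 5 (∃′ 6 (∃′ 7 (∃′ 8 (∃′ 9 (∃′ 10 (∃′ 11 (
       rel mult (var 4 ∷ var 1 ∷ var 5 ∷ [])
    ∧′ rel add (var 5 ∷ var 6 ∷ var 0 ∷ [])
    ∧′ rel lt (var 6 ∷ var 1 ∷ [])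
    ∧′ rel mult (var 6 ∷ numeral k ∷ var 7 ∷ [])
    ∧′ rel add (var 7 ∷ numeral (suc i) ∷ var 8 ∷ [])
    ∧′ rel mult (var 8 ∷ var 2 ∷ var 9 ∷ [])
    ∧′ rel add (var 9 ∷ numeral 1 ∷ var 10 ∷ [])
    ∧′ rel mult (var 11 ∷ var 10 ∷ var 3 ∷ [])))))))))

  data TermsBelow (n : ℕ) : ∀ {l} → Vec (Term τ) l → Set where
    []      : TermsBelow n []
    var     : ∀ {l} {ts : Vec (Term τ) l} y → {T (y <ᵇ n)} → TermsBelow n ts → TermsBelow n (var y ∷ ts)
    num : ∀ {l} {ts : Vec (Term τ) l} j → TermsBelow n ts → TermsBelow n (numeral j ∷ ts)

  occurs-below : ∀ {n l x} {ts : Vec (Term τ) l} → TermsBelow n ts → OccursInTerms x ts → x < n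
  occurs-below {n} (var y {y<n} ts<n) (inj₁ refl) = <ᵇ⇒< y n y<n
  occurs-below (var y ts<n)           (inj₂ occ)  = occurs-below ts<n occ
  occurs-below (num j ts<n)       (inj₁ occ)  = contradiction occ (numeral-closed j)
  occurs-below (num j ts<n)       (inj₂ occ)  = occurs-below ts<n occ

  rel-below : ∀ {n l} {R : Rel τ l} {ts} → TermsBelow n ts → FreeBelow n (rel R ts)
  rel-below ts<n = freeBelow λ x → occurs-below ts<n

  ∧-below : ∀ {n} {χ χ′ : Formula τ} → FreeBelow n χ → FreeBelow n χ′ → FreeBelow n (χ ∧′ χ′)
  ∧-below χ<n χ′<n = freeBelow λ x → [ free< χ<n x , free< χ′<n x ]′

  ∃-below : ∀ {n} {χ : Formula τ} → FreeBelow (suc n) χ → FreeBelow n (∃′ n χ)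
  ∃-below χ<n = freeBelow λ x (x≢n , f) → ≤∧≢⇒< (≤-pred (free< χ<n x f)) x≢n

  hashed-colorFormula : ∀ k i → ColorFormula (hashed k i)
  hashed-colorFormula k i = record
    { free<4   = ∃-below (∃-below (∃-below (∃-below (∃-below (∃-below (∃-below (∃-below (
        ∧-below (rel-below (var 4 (var 1 (var 5 [])))) (
        ∧-below (rel-below (var 5 (var 6 (var 0 [])))) (
        ∧-below (rel-below (var 6 (var 1 []))) (
        ∧-below (rel-below (var 6 (num k (var 7 [])))) (
        ∧-below (rel-below (var 7 (num (suc i) (var 8 [])))) (
        ∧-below (rel-below (var 8 (var 2 (var 9 [])))) (
        ∧-below (rel-below (var 9 (num 1 (var 10 []))))
                (rel-below (var 11 (var 10 (var 3 []))))))))))))))))))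
    ; qr≤8     = ≤-refl
    ; bound<12 = All.map (λ {x} → <ᵇ⇒< x 12) (tt ∷ tt ∷ tt ∷ tt ∷ tt ∷ tt ∷ tt ∷ tt ∷ [])
    }

  -- g lists the colours of the elements s, s + 1, …
  listed : ∀ {k n} → ℕ → Vec (Fin k) n → Fin k → Formula τ
  listed s []      i = ¬′ (var 0 ≐ var 0)
  listed s (d ∷ g) i with d Fin.≟ i
  ... | yes _ = var 0 ≐ numeral s ∨′ listed (suc s) g i
  ... | no  _ = listed (suc s) g i

  listed-colorFormula : ∀ {k n} s (g : Vec (Fin k) n) i → ColorFormula (listed s g i)
  listed-colorFormula s []      i = colorFormula-¬ (colorFormula-≐ λ { x refl → s≤s z≤n })
  listed-colorFormula s (d ∷ g) i with d Fin.≟ i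
  ... | yes _ = colorFormula-∨ (colorFormula-≐ λ x occ → contradiction occ (numeral-closed s))
                               (listed-colorFormula (suc s) g i)
  ... | no  _ = listed-colorFormula (suc s) g i

module Semantics {τ : Signature} {ar : Arithmetic τ} {A : Structure τ} (st : STRUC ar A) where
  open Structure A
  open ArithmeticSymbols ar A renaming (_<_ to _≺_; _<ᵇ_ to _≺ᵇ_)
  open STRUC st
  open Syntax ar
  open IsStrictTotalOrder <-linear using (compare; irrefl) renaming (trans to ≺-trans)

  ∈-elements : ∀ x → x Vec.∈ elements
  ∈-elements x = subst (Vec._∈ elements) (Inverse.strictlyInverseʳ (proj₂ finite) x)
    (Vec.∈-tabulate⁺ (Inverse.from (proj₂ finite)) (Inverse.to (proj₂ finite) x))

  rank-mono : ∀ {x y} → x ≺ y → rank x < rank y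
  rank-mono {x} {y} x≺y = countᵇ-strict (λ z z≺x → ≺-trans z≺x x≺y) (∈-elements x) (irrefl refl) x≺y

  rank-cancel : ∀ {x y} → rank x < rank y → x ≺ y
  rank-cancel {x} {y} rx<ry with compare x y
  ... | tri< x≺y _ _  = x≺y
  ... | tri≈ _ refl _ = contradiction rx<ry (<-irrefl refl)
  ... | tri> _ _ y≺x  = contradiction rx<ry (<-asym (rank-mono y≺x))

  rank-injective : ∀ {x y} → rank x ≡ rank y → x ≡ y
  rank-injective {x} {y} eq with compare x y
  ... | tri< x≺y _ _ = contradiction (rank-mono x≺y) (<-irrefl eq)
  ... | tri≈ _ x≡y _ = x≡y
  ... | tri> _ _ y≺x = contradiction (rank-mono y≺x) (<-irrefl (sym eq))

  greatest : Carrier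
  greatest = argmax rank Zero (Vec.toList elements)

  top : ℕ
  top = rank greatest

  rank≤top : ∀ x → rank x ≤ top
  rank≤top x = All.lookup (f[xs]≤f[argmax] Zero (Vec.toList elements)) (Vec.∈-toList⁺ (∈-elements x))

  value : ℕ → Carrier
  value zero    = Zero
  value (suc j) = Succ (value j)

  eval-numeral : ∀ {ρ} j → eval A ρ (numeral j) ≡ value j
  eval-numeral zero    = refl
  eval-numeral (suc j) = cong Succ (eval-numeral j)

  -- While j is below `top`, `value j` lies strictly below the greatest element, so its successor is
  -- not truncated.
  rank-value : ∀ {j} → j ≤ top → rank (value j) ≡ j
  rank-value {zero}  _     = countᵇ-none zero-min elements
  rank-value {suc j} j<top = trans (succ-next (value j) greatest below) (cong suc rank≡j)
    where
    rank≡j : rank (value j) ≡ j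
    rank≡j = rank-value (<⇒≤ j<top)
    below : value j ≺ greatest
    below = rank-cancel (subst (_< top) (sym rank≡j) j<top)

  value-rank : ∀ x → value (rank x) ≡ x
  value-rank x = rank-injective (rank-value (rank≤top x))

  Add-intro : ∀ {x y z} → rank x + rank y ≡ rank z → Add x y z
  Add-intro = from (add-rank _ _ _)

  Mult-intro : ∀ {x y z} → rank x * rank y ≡ rank z → Mult x y z
  Mult-intro = from (mult-rank _ _ _)

  module _ {k : ℕ} (c : Carrier → Fin k) where

    colorsFrom : ℕ → ∀ n → Vec (Fin k) n
    colorsFrom s zero    = []
    colorsFrom s (suc n) = c (value s) ∷ colorsFrom (suc s) n

    -- A numeral past the maximum still denotes `value s`, and `colorsFrom` records the colour of
    -- that very element, so surplus entries do no harm.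
    listed-sound : ∀ ρ s n {i} → Sat A ρ (listed s (colorsFrom s n) i) → i ≡ c (ρ 0)
    listed-sound ρ s zero    sat = contradiction refl sat
    listed-sound ρ s (suc n) {i} sat with c (value s) Fin.≟ i
    ... | no _ = listed-sound ρ (suc s) n sat
    listed-sound ρ s (suc n) {i} (inj₁ eq)  | yes c≡i =
      trans (sym c≡i) (cong c (sym (trans eq (eval-numeral s))))
    listed-sound ρ s (suc n) {i} (inj₂ sat) | yes _ = listed-sound ρ (suc s) n sat

    listed-complete : ∀ ρ s n → s ≤ rank (ρ 0) → rank (ρ 0) < s + n →
      Sat A ρ (listed s (colorsFrom s n) (c (ρ 0)))
    listed-complete ρ s zero    s≤ <s =
      contradiction (≤-trans <s (≤-reflexive (+-identityʳ s))) (≤⇒≯ s≤)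
    listed-complete ρ s (suc n) s≤ <s with c (value s) Fin.≟ c (ρ 0) | s ≟ rank (ρ 0)
    ... | yes _  | yes refl = inj₁ (sym (trans (eval-numeral s) (value-rank (ρ 0))))
    ... | no c≢c | yes refl = contradiction (cong c (value-rank (ρ 0))) c≢c
    ... | yes _  | no s≢    =
      inj₂ (listed-complete ρ (suc s) n (≤∧≢⇒< s≤ s≢) (subst (rank (ρ 0) <_) (+-suc s n) <s))
    ... | no _   | no s≢    =
      listed-complete ρ (suc s) n (≤∧≢⇒< s≤ s≢) (subst (rank (ρ 0) <_) (+-suc s n) <s)

  rank-eval : ∀ {ρ j} → j ≤ top → rank (eval A ρ (numeral j)) ≡ j
  rank-eval {ρ} {j} j≤top = trans (cong rank (eval-numeral {ρ} j)) (rank-value j≤top)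

  module Hashed {k-1 : ℕ} {xs : List ℕ} {c : ℕ → ℕ} {m b a : ℕ}
    (enc : Encodes (suc k-1) top xs c m b a) (ρ : ℕ → Carrier) (x∈ : rank (ρ 0) ∈ xs)
    (ρ1 : rank (ρ 1) ≡ m) (ρ2 : rank (ρ 2) ≡ b) (ρ3 : rank (ρ 3) ≡ a)
    {i : ℕ} (i<k : i < suc k-1) where
    open Encodes enc

    private
      k = suc k-1
      x = rank (ρ 0)
      index = colorIndex k (x % m) i
      suc-i≤ : suc i ≤ top
      suc-i≤ = ≤-trans (m≤n+m (suc i) (x % m * k)) (index≤t x∈ i<k)
      1≤ : 1 ≤ top
      1≤ = ≤-trans (s≤s z≤n) suc-i≤
      -- The index of the last colour k - 1 has k itself as a summand.
      k≤ : k ≤ top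
      k≤ = ≤-trans (m≤n+m k (x % m * k)) (index≤t x∈ ≤-refl)

    sat⇒code-∣ : Sat A ρ (hashed k i) → code x i ∣ a
    sat⇒code-∣ (q , e , y , z , u , v , w , s ,
                qm≡e , e+y≡x , y≺m , yk≡z , z+i≡u , ub≡v , v+1≡w , sw≡a) =
      divides (rank s) (begin
        a                       ≡⟨ ρ3 ⟨
        rank (ρ 3)              ≡⟨ to (mult-rank _ _ _) sw≡a ⟨
        rank s * rank w         ≡⟨ cong (rank s *_) rank-w ⟩
        rank s * code x i       ∎)
      where
      open ≡-Reasoning
      rank-y : rank y ≡ x % m
      rank-y = begin
        rank y                      ≡⟨ m<n⇒m%n≡m (subst (rank y <_) ρ1 (rank-mono y≺m)) ⟨
        rank y % m                  ≡⟨ [m+kn]%n≡m%n (rank y) (rank q) m ⟨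
        (rank y + rank q * m) % m   ≡⟨ cong (_% m) (begin
          rank y + rank q * m           ≡⟨ +-comm (rank y) _ ⟩
          rank q * m + rank y           ≡⟨ cong (λ n → rank q * n + rank y) ρ1 ⟨
          rank q * rank (ρ 1) + rank y  ≡⟨ cong (_+ rank y) (to (mult-rank _ _ _) qm≡e) ⟩
          rank e + rank y               ≡⟨ to (add-rank _ _ _) e+y≡x ⟩
          x                             ∎) ⟩
        x % m                       ∎
      rank-z : rank z ≡ x % m * k
      rank-z = trans (sym (to (mult-rank _ _ _) yk≡z)) (cong₂ _*_ rank-y (rank-eval k≤))
      rank-u : rank u ≡ index
      rank-u = trans (sym (to (add-rank _ _ _) z+i≡u)) (cong₂ _+_ rank-z (rank-eval suc-i≤))
      rank-v : rank v ≡ index * b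
      rank-v = trans (sym (to (mult-rank _ _ _) ub≡v)) (cong₂ _*_ rank-u ρ2)
      rank-w : rank w ≡ code x i
      rank-w = trans (sym (to (add-rank _ _ _) v+1≡w))
        (trans (cong₂ _+_ rank-v (rank-eval {ρ} 1≤)) (+-comm (index * b) 1))

    -- Each witness is the element whose rank is the intended number; it exists by the bounds in
    -- `Encodes` and because the rank x is at most `top`.
    code-∣⇒sat : code x i ∣ a → Sat A ρ (hashed k i)
    code-∣⇒sat (divides s a≡s*code) =
      value (x / m) , value (x / m * m) , value (x % m) , value (x % m * k) , value index ,
      value (index * b) , value (code x i) , value s ,
      Mult-intro (trans (cong₂ _*_ rank-q ρ1) (sym rank-e)) ,
      Add-intro (trans (cong₂ _+_ rank-e rank-y) (sym x≡)) ,
      rank-cancel (subst₂ _<_ (sym rank-y) (sym ρ1) (m%n<n x m)) ,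
      Mult-intro (trans (cong₂ _*_ rank-y (rank-eval k≤)) (sym rank-z)) ,
      Add-intro (trans (cong₂ _+_ rank-z (rank-eval suc-i≤)) (sym rank-u)) ,
      Mult-intro (trans (cong₂ _*_ rank-u ρ2) (sym rank-v)) ,
      Add-intro (trans (cong₂ _+_ rank-v (rank-eval {ρ} 1≤)) (trans (+-comm (index * b) 1) (sym rank-w))) ,
      Mult-intro (trans (cong₂ _*_ rank-s rank-w) (trans (sym a≡s*code) (sym ρ3)))
      where
      x≡ : x ≡ x / m * m + x % m
      x≡ = trans (m≡m%n+[m/n]*n x m) (+-comm (x % m) _)
      rank-q : rank (value (x / m)) ≡ x / m
      rank-q = rank-value (≤-trans (m/n≤m x m) (rank≤top (ρ 0)))
      rank-e : rank (value (x / m * m)) ≡ x / m * m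
      rank-e = rank-value (≤-trans (m/n*n≤m x m) (rank≤top (ρ 0)))
      rank-y : rank (value (x % m)) ≡ x % m
      rank-y = rank-value (≤-trans (m%n≤m x m) (rank≤top (ρ 0)))
      rank-z : rank (value (x % m * k)) ≡ x % m * k
      rank-z = rank-value (≤-trans (m≤m+n _ (suc i)) (index≤t x∈ i<k))
      rank-u : rank (value index) ≡ index
      rank-u = rank-value (index≤t x∈ i<k)
      rank-v : rank (value (index * b)) ≡ index * b
      rank-v = rank-value (≤-trans (n≤1+n _) (code≤t x∈ i<k))
      rank-w : rank (value (code x i)) ≡ code x i
      rank-w = rank-value (code≤t x∈ i<k)
      -- The cofactor is at most its product with the positive code, which is `a`.
      rank-s : rank (value s) ≡ s
      rank-s = rank-value (≤-trans (≤-trans (m≤m*n s (code x i)) (≤-reflexive (sym a≡s*code))) a≤t)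

-- Families of colourings that realise every prescription

module _ {τ : Signature} {k-1 : ℕ} (ar : Arithmetic τ) where
  open Syntax ar

  private
    k = suc k-1

  ColorFormulas : Set
  ColorFormulas = Fin k → Formula τ

  hashedColors : ColorFormulas
  hashedColors i = hashed k (toℕ i)

  allVecs : ∀ N → List (Vec (Fin k) N)
  allVecs zero    = [] ∷ []
  allVecs (suc N) = cartesianProductWith _∷_ (allFin k) (allVecs N)

  ∈-allVecs : ∀ {N} (g : Vec (Fin k) N) → g ∈ allVecs N
  ∈-allVecs []      = here refl
  ∈-allVecs (d ∷ g) = ∈-cartesianProductWith⁺ _∷_ (∈-allFin d) (∈-allVecs g)

  listedColors : ∀ N → List ColorFormulas
  listedColors N = map (listed 0) (allVecs N)

  listedColors-colorFormula : ∀ N → All (λ θ → ∀ i → ColorFormula (θ i)) (listedColors N)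
  listedColors-colorFormula N = All.tabulate λ θ∈ → case ∈-map⁻ (listed 0) θ∈ of λ where
    (g , _ , refl) → listed-colorFormula 0 g

  -- φ′ does not test the size of the structure: offering both kinds of families is sound, since
  -- every member defines a colouring.
  candidates : ℕ → List ColorFormulas
  candidates N = hashedColors ∷ listedColors N

  candidates-colorFormula : ∀ N → All (λ θ → ∀ i → ColorFormula (θ i)) (candidates N)
  candidates-colorFormula N = (λ i → hashed-colorFormula k (toℕ i)) ∷ listedColors-colorFormula N

  module _ {A : Structure τ} (st : STRUC ar A) where
    open Structure A
    open Semantics st
    open ArithmeticSymbols ar A using (rank; Zero)

    Realised : List ColorFormulas → List Carrier → (Carrier → Fin k) → Set
    Realised θs X c = ∃ λ θ → θ ∈ θs ×
      ∃ λ p → ∃ λ q → ∃ λ r → ∀ {x} → x ∈ X → colorOf A θ p q r x ≡ c x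

    listed-realised : ∀ {N} → top < N → ∀ X c → Realised (listedColors N) X c
    listed-realised {N} top<N X c = θ , ∈-map⁺ (listed 0) (∈-allVecs g) , Zero , Zero , Zero ,
      λ {x} _ → let ρ = parameters A θ Zero Zero Zero x in
        firstColor-unique _ (c x) (listed-complete c ρ 0 N z≤n (≤-<-trans (rank≤top x) top<N))
          (λ j → listed-sound c ρ 0 N)
      where
      g = colorsFrom c 0 N
      θ = listed 0 g

    hashed-realised : ∀ X c {m b a} → Encodes k top (map rank X) (toℕ ∘ c ∘ value) m b a →
      ∀ p q r → rank p ≡ m → rank q ≡ b → rank r ≡ a → ∀ {N} → Realised (candidates N) X c
    hashed-realised X c {m} {b} {a} enc p q r p≡m q≡b r≡a =
      hashedColors , here refl , p , q , r , agree
      where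
      open Encodes enc
      agree : ∀ {x} → x ∈ X → colorOf A hashedColors p q r x ≡ c x
      -- On `X` exactly the prescribed colour passes the divisibility test, so neither the order of
      -- the tests nor the default matters.
      agree {x} x∈ = firstColor-unique _ (c x)
        (H.code-∣⇒sat (Fin.toℕ<n (c x))
          (subst (λ y → code (rank x) (toℕ (c y)) ∣ a) (value-rank x) (code-color rank∈)))
        (λ j sat → Fin.toℕ-injective (trans
          (code-sound rank∈ (Fin.toℕ<n j) (H.sat⇒code-∣ (Fin.toℕ<n j) sat))
          (cong (toℕ ∘ c) (value-rank x))))
        where
        rank∈ = ∈-map⁺ rank x∈
        module H = Hashed enc (parameters A hashedColors p q r x) rank∈ p≡m q≡b r≡a

    ranks≤top : ∀ X {n} → n ∈ map rank X → n ≤ top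
    ranks≤top X n∈ with ∈-map⁻ rank n∈
    ... | y , _ , refl = rank≤top y

    realised : ∀ {ℓ} (enc : Encodable k ℓ) X → length X ≤ ℓ → ∀ c →
      Realised (candidates (proj₁ enc)) X c
    realised (N , encode) X len c with ≤-<-connex N top
    ... | inj₂ top<N = let θ , θ∈ , p = listed-realised top<N X c in θ , there θ∈ , p
    ... | inj₁ N≤top = encoded (encode N≤top (map rank X)
            (≤-trans (≤-reflexive (length-map rank X)) len) (ranks≤top X)
            (toℕ ∘ c ∘ value) (λ j → Fin.toℕ<n (c (value j))))
      where
      encoded : (∃ λ m → ∃ λ b → ∃ λ a → Encodes k top (map rank X) (toℕ ∘ c ∘ value) m b a) →
        Realised (candidates N) X c
      encoded (m , b , a , enc) = hashed-realised X c enc (value m) (value b) (value a)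
        (rank-value m≤t) (rank-value b≤t) (rank-value a≤t)
        where open Encodes enc

-- The sentence without colours and its equivalence

module _ {τ : Signature} {k-1 : ℕ} (φ : Formula (τ colors suc k-1)) where

  private
    k = suc k-1

  uncolored : (Fin k → Formula τ) → Formula τ
  uncolored θ = Translate.translate (first θ) φ

  -- A separate head makes the list nonempty: an empty disjunction would be a false formula lacking
  -- the quantifiers of φ, against `Simulates`.
  anyUncolored : (Fin k → Formula τ) → List (Fin k → Formula τ) → Formula τ
  anyUncolored θ []        = uncolored θ
  anyUncolored θ (θ′ ∷ θs) = uncolored θ ∨′ anyUncolored θ′ θs

  anyUncolored-simulates : ∀ {θ θs} → All (λ θ → ∀ i → ColorFormula (θ i)) (θ ∷ θs) →
    Simulates φ (anyUncolored θ θs)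
  anyUncolored-simulates {θ} {[]} (θ-ok ∷ []) =
    translate-simulates (first θ) (first-colorFormula θ θ-ok) φ
  anyUncolored-simulates {θ} {_ ∷ _} (θ-ok ∷ θs-ok) = simulates-either
    (translate-simulates (first θ) (first-colorFormula θ θ-ok) φ) (anyUncolored-simulates θs-ok)

  module _ (A : Structure τ) {ρ : ℕ → Structure.Carrier A} where

    sat-anyUncolored⁻ : ∀ {θ θs} → Sat A ρ (anyUncolored θ θs) →
      ∃ λ θ′ → θ′ ∈ θ ∷ θs × Sat A ρ (uncolored θ′)
    sat-anyUncolored⁻ {θ} {[]}    sat        = θ , here refl , sat
    sat-anyUncolored⁻ {θ} {_ ∷ _} (inj₁ sat) = θ , here refl , sat
    sat-anyUncolored⁻ {θ} {_ ∷ _} (inj₂ sat) =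
      map₂ (λ (θ∈ , sat) → there θ∈ , sat) (sat-anyUncolored⁻ sat)

    sat-anyUncolored⁺ : ∀ {θ θs θ′} → θ′ ∈ θ ∷ θs → Sat A ρ (uncolored θ′) →
      Sat A ρ (anyUncolored θ θs)
    sat-anyUncolored⁺ {θs = []}    (here refl) sat = sat
    sat-anyUncolored⁺ {θs = _ ∷ _} (here refl) sat = inj₁ sat
    sat-anyUncolored⁺ {θs = _ ∷ _} (there θ∈)  sat = inj₂ (sat-anyUncolored⁺ θ∈ sat)

  -- Only the support of one witness is copied; elsewhere the colouring given by the parameters may
  -- differ from that of B.
  coloring⇒sat : (ar : Arithmetic τ) (enc : Encodable k (colorAtoms φ)) →
    IsSentence φ → NNF φ → NoColorUnder∀ φ →
    ∀ {A} → STRUC ar A → ∀ {B} → IsColoring k A B → B ⊨ φ →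
    A ⊨ closure (anyUncolored (hashedColors ar) (listedColors ar (proj₁ enc)))
  coloring⇒sat ar enc sentence nnf noc {A} st {B} record { restricts = refl ; partition = partition } B⊨φ ρ
    with supported B ρ φ nnf noc (B⊨φ ρ)
  ... | X , len , onX with realised ar st enc X len (proj₁ ∘ partition)
  ... | θ , θ∈ , p , q , r , agree = p , q , r , sat-anyUncolored⁺ A θ∈
    (from (Translate.sat-translate (first θ) A (colorOf A θ)
             (sat-colorOf A θ (All.lookup (candidates-colorFormula ar (proj₁ enc)) θ∈)) _ φ)
      -- The support was found at ρ, whereas the translation is read at a shifted assignment; for a
      -- sentence both agree.
      (sentence-⊨ (paint A (colorOf A θ p q r)) φ sentence (onX _ at) _))
    where
    at : ∀ {x} → x ∈ X → ColorAt B (colorOf A θ p q r) x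
    at {x} x∈ i with partition x | agree x∈
    ... | j , colored , unique | c≡j = mk⇔
      (λ t → fromWitness (trans c≡j (unique t)))
      (λ t → subst (λ i → T (Structure.⟦rel⟧ B (color i) (x ∷ [])))
               (trans (sym c≡j) (toWitness t)) colored)

  -- Whatever the parameters are, `colorOf` is a total function, and painting with it yields a
  -- partition.
  sat⇒coloring : ∀ {θ θs} → All (λ θ → ∀ i → ColorFormula (θ i)) (θ ∷ θs) → IsSentence φ →
    (A : Structure τ) → Structure.Carrier A → A ⊨ closure (anyUncolored θ θs) →
    ∃ λ B → IsColoring k A B × B ⊨ φ
  sat⇒coloring θs-ok sentence A a₀ A⊨ with A⊨ (λ _ → a₀)
  ... | p , q , r , sat with sat-anyUncolored⁻ A sat
  ... | θ , θ∈ , satθ = paint A c , paint-isColoring A c , sentence-⊨ (paint A c) φ sentence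
    (to (Translate.sat-translate (first θ) A (colorOf A θ)
          (sat-colorOf A θ (All.lookup θs-ok θ∈)) _ φ) satθ)
    where c = colorOf A θ p q r

theorem3p1 : ∃ λ (c : ℕ) →
    ∀ (τ : Signature) (ar : Arithmetic τ) (k : ℕ) (φ : Formula (τ colors k)) →
    IsSentence φ → NNF φ → NoColorUnder∀ φ →
    ∃ λ (φ′ : Formula τ) →
    IsSentence φ′
    × (∀ (A : Structure τ) → STRUC ar A →
    (A ⊨ φ′) ⇔ (∃ λ (B : Structure (τ colors k)) → IsColoring k A B × (B ⊨ φ)))
    × (∣ qr φ′ - qr φ ∣ ≤ c)
    × (∣ length (bound φ′) - length (bound φ) ∣ ≤ c)
theorem3p1 = 12 , λ where
  -- The constant 0 makes each structure nonempty, and without colours a nonempty structure has no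
  -- colouring, so φ′ must be false.
  τ ar zero φ sentence nnf noc →
    let s = simulates-never (translate-simulates (λ ()) (λ ()) φ) in
    closure (Translate.translate (λ ()) φ ∧′ ¬′ (var 1 ≐ var 1))
    , closure-sentence s sentence
    , (λ A st → let a₀ = ArithmeticSymbols.Zero ar A in mk⇔
        (λ A⊨ → case A⊨ (λ _ → a₀) of λ (_ , _ , _ , _ , ≢) → contradiction refl ≢)
        (λ (B , coloring , _) → case coloring of λ where
          record { restricts = refl ; partition = partition } → case partition a₀ of λ ()))
    , closure-qr s , closure-bound s
  τ ar (suc k-1) φ sentence nnf noc →
    let enc = encodable (suc k-1) (colorAtoms φ)
        θs-ok = candidates-colorFormula ar (proj₁ enc)
        s = anyUncolored-simulates φ θs-ok in
    closure (anyUncolored φ (hashedColors ar) (listedColors ar (proj₁ enc)))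
    , closure-sentence s sentence
    , (λ A st → mk⇔
        (sat⇒coloring φ θs-ok sentence A (ArithmeticSymbols.Zero ar A))
        (λ (B , coloring , B⊨φ) → coloring⇒sat φ ar enc sentence nnf noc st coloring B⊨φ))
    , closure-qr s , closure-bound s
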